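{- Let $n\ge0$ and let $H_n$ be the pyrene system with $n$ pyrene fragments. Then $$IDF(H_n)=\frac{\sqrt{2}}{32}(3-2\sqrt{2})^n+\frac{7-5\sqrt{2}}{8}n(3-2\sqrt{2})^n-\frac{\sqrt{2}}{32}(3+2\sqrt{2})^n+\frac{7+5\sqrt{2}}{8}n(3+2\sqrt{2})^n.$$
   Context: Pyrene system: draw the hexagonal lattice so that every hexagon has two vertical sides; horizontally adjacent hexagons then share a vertical edge. For $n\ge1$, $H_n$ is the hexagonal system (the plane graph formed by the vertices and edges of the following $4n$ hexagons) consisting of a horizontal linear row of $2n$ hexagons $h_{1,1},h_{1,2},\dots,h_{n,1},h_{n,2}$, consecutive ones sharing a vertical edge, together with, for each $i$, a hexagon $s_{i,1}$ directly above and a hexagon $s_{i,2}$ directly below the common edge of $h_{i,1}$ and $h_{i,2}$ (each sharing an edge with both $h_{i,1}$ and $h_{i,2}$). $H_0$ is the null graph, which has exactly one (empty) perfect matching with forcing number $0$. For a perfect matching $M$ of $G$, a forcing set is a subset $S\subseteq M$ contained in no other perfect matching of $G$, and the forcing number $f(G,M)$ is the minimum size of a forcing set. The degree of freedom $IDF(G)$ is $\sum_{M}f(G,M)$, summed over all perfect matchings $M$ of $G$. -}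

module Defs where

open import Data.Nat.ListAction using (sum)
open import Data.Nat as ℕ using (ℕ; zero; suc; NonZero)
import Data.Nat.Properties as ℕₚ
open import Data.Integer using (+_)
open import Data.Rational as ℚ using (ℚ; 0ℚ; 1ℚ)
open import Data.List using (List; []; _∷_; _++_; map; concatMap; filter; length; upTo; deduplicate)
open import Data.List.Extrema.Nat using (min)
open import Data.List.Membership.Propositional using (_∈_; _∉_; find)
open import Data.List.Membership.Propositional.Properties using (∈-deduplicate⁺; ∈-deduplicate⁻; ∈-concatMap⁺; ∈-concatMap⁻)
import Data.List.Properties as Listₚ
open import Data.List.Relation.Binary.Subset.Propositional using (_⊆_)
import Data.List.Relation.Binary.Subset.DecPropositional as DecSubset
open import Data.List.Relation.Unary.All as All using (All; all?)
open import Data.List.Relation.Unary.Any as Any using (here; there)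
open import Data.List.Relation.Unary.Unique.Propositional using (Unique)
open import Data.List.Relation.Unary.Unique.DecPropositional.Properties using (deduplicate-!)
open import Data.Product using (_×_; _,_; proj₁; proj₂)
open import Data.Product.Properties using (≡-dec)
open import Data.Sum using (_⊎_)
open import Relation.Binary.Definitions using (DecidableEquality)
open import Relation.Binary.PropositionalEquality using (_≡_; refl)
open import Relation.Nullary using (Dec)
open import Relation.Nullary.Decidable using (_⊎-dec_; _→-dec_)

-- Finite simple graphs.  An undirected edge {u , v} is listed exactly once,
-- as one of the two pairs (u , v), (v , u); asymmetry also excludes loops.

record Graph : Set₁ where
  field
    V               : Set
    _≟_             : DecidableEquality V
    vertices        : List V
    edges           : List (V × V)
    vertices-unique : Unique vertices
    edges-unique    : Unique edges
    edges-asym      : ∀ {u v} → (u , v) ∈ edges → (v , u) ∉ edges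
    endpoints       : ∀ {u v} → (u , v) ∈ edges → u ∈ vertices × v ∈ vertices

  Edge : Set
  Edge = V × V

  _≟ᴱ_ : DecidableEquality Edge
  _≟ᴱ_ = ≡-dec _≟_ _≟_

-- For a duplicate-free list, each subset of its elements is the set of
-- elements of exactly one member of `subsets`.

subsets : ∀ {A : Set} → List A → List (List A)
subsets []       = [] ∷ []
subsets (x ∷ xs) = map (x ∷_) (subsets xs) ++ subsets xs

module _ (G : Graph) where
  open Graph G
  open DecSubset _≟ᴱ_ using (_⊆?_)

  Incident : V → Edge → Set
  Incident v (u , w) = v ≡ u ⊎ v ≡ w

  incident? : ∀ v e → Dec (Incident v e)
  incident? v (u , w) = (v ≟ u) ⊎-dec (v ≟ w)

  degree : List Edge → V → ℕ
  degree M v = length (filter (incident? v) M)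

  IsPerfect : List Edge → Set
  IsPerfect M = All (λ v → degree M v ≡ 1) vertices

  isPerfect? : ∀ M → Dec (IsPerfect M)
  isPerfect? M = all? (λ v → degree M v ℕ.≟ 1) vertices

  perfectMatchings : List (List Edge)
  perfectMatchings = filter isPerfect? (subsets edges)

  -- Perfect matchings are members of `subsets edges`, so equality of lists
  -- is equality of edge sets here.

  IsForcing : List Edge → List Edge → Set
  IsForcing M S = All (λ M′ → S ⊆ M′ → M′ ≡ M) perfectMatchings

  isForcing? : ∀ M S → Dec (IsForcing M S)
  isForcing? M S =
    all? (λ M′ → (S ⊆? M′) →-dec Listₚ.≡-dec _≟ᴱ_ M′ M) perfectMatchings

  forcingSets : List Edge → List (List Edge)
  forcingSets M = filter (isForcing? M) (subsets M)

  -- The default value `length M` of the minimum is harmless: a perfect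
  -- matching M is a forcing set of itself.

  forcingNumber : List Edge → ℕ
  forcingNumber M = min (length M) (map length (forcingSets M))

  IDF : ℕ
  IDF = sum (map forcingNumber perfectMatchings)

-- The hexagonal lattice with vertical sides, in coordinates scaled so that
-- the unit is half the width of a hexagon horizontally and half the side
-- length vertically.  A hexagon is named by the lower left corner (x , y) of
-- its bounding box [x , x+2] × [y , y+4]; its right, upper left and upper
-- right neighbours are (x+2 , y), (x-1 , y+3) and (x+1 , y+3).

Point : Set
Point = ℕ × ℕ

_≟ᴾ_ : DecidableEquality Point
_≟ᴾ_ = ≡-dec ℕ._≟_ ℕ._≟_

module Hexagon (c : Point) where
  open import Data.Nat using (_+_)

  private
    x = proj₁ c
    y = proj₂ c

  bottom lowerLeft lowerRight upperLeft upperRight top : Point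
  bottom     = x + 1 , y
  lowerLeft  = x     , y + 1
  lowerRight = x + 2 , y + 1
  upperLeft  = x     , y + 3
  upperRight = x + 2 , y + 3
  top        = x + 1 , y + 4

  vertices : List Point
  vertices = bottom ∷ lowerLeft ∷ lowerRight ∷ upperLeft ∷ upperRight ∷ top ∷ []

  -- Each edge is listed from its lower to its upper end, so that hexagons
  -- sharing an edge list the same pair.

  edges : List (Point × Point)
  edges = (bottom , lowerLeft) ∷ (bottom , lowerRight)
        ∷ (lowerLeft , upperLeft) ∷ (lowerRight , upperRight)
        ∷ (upperLeft , top) ∷ (upperRight , top) ∷ []

  edges-upward : All (λ e → proj₂ (proj₁ e) ℕ.< proj₂ (proj₂ e)) edges
  edges-upward = up₀ 0 All.∷ up₀ 0 All.∷ up 1 1 All.∷ up 1 1 All.∷ up 3 0 All.∷ up 3 0 All.∷ All.[]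
    where
    up₀ : ∀ d → y ℕ.< y + suc d
    up₀ _ = ℕₚ.m<m+n y (ℕ.s≤s ℕ.z≤n)

    up : ∀ a d → y + a ℕ.< y + (suc a + d)
    up a d = ℕₚ.+-monoʳ-< y (ℕₚ.m≤m+n (suc a) d)

  endpoints : All (λ e → proj₁ e ∈ vertices × proj₂ e ∈ vertices) edges
  endpoints = (#0 , #1) All.∷ (#0 , #2) All.∷ (#1 , #3) All.∷ (#2 , #4) All.∷ (#3 , #5) All.∷ (#4 , #5) All.∷ All.[]
    where
    #0 = here refl
    #1 = there (here refl)
    #2 = there (there (here refl))
    #3 = there (there (there (here refl)))
    #4 = there (there (there (there (here refl))))
    #5 = there (there (there (there (there (here refl)))))

hexagonalSystem : List Point → Graph
hexagonalSystem hs = record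
  { V               = Point
  ; _≟_             = _≟ᴾ_
  ; vertices        = deduplicate _≟ᴾ_ vs
  ; edges           = deduplicate _≟ᴱ_ es
  ; vertices-unique = deduplicate-! _≟ᴾ_ vs
  ; edges-unique    = deduplicate-! _≟ᴱ_ es
  ; edges-asym      = λ p q → ℕₚ.<-asym (upward p) (upward q)
  ; endpoints       = ends
  }
  where
  _≟ᴱ_ : DecidableEquality (Point × Point)
  _≟ᴱ_ = ≡-dec _≟ᴾ_ _≟ᴾ_

  vs = concatMap Hexagon.vertices hs
  es = concatMap Hexagon.edges hs

  upward : ∀ {u v} → (u , v) ∈ deduplicate _≟ᴱ_ es → proj₂ u ℕ.< proj₂ v
  upward p with find (∈-concatMap⁻ Hexagon.edges {xs = hs} (∈-deduplicate⁻ _≟ᴱ_ es p))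
  ... | h , _ , q = All.lookup (Hexagon.edges-upward h) q

  ends : ∀ {u v} → (u , v) ∈ deduplicate _≟ᴱ_ es →
         u ∈ deduplicate _≟ᴾ_ vs × v ∈ deduplicate _≟ᴾ_ vs
  ends p with ∈-concatMap⁻ Hexagon.edges {xs = hs} (∈-deduplicate⁻ _≟ᴱ_ es p)
  ... | q = lift (Any.map (λ {h} r → proj₁ (All.lookup (Hexagon.endpoints h) r)) q)
          , lift (Any.map (λ {h} r → proj₂ (All.lookup (Hexagon.endpoints h) r)) q)
    where
    lift : ∀ {w} → Any.Any (λ h → w ∈ Hexagon.vertices h) hs → w ∈ deduplicate _≟ᴾ_ vs
    lift r = ∈-deduplicate⁺ _≟ᴾ_ (∈-concatMap⁺ Hexagon.vertices r)

-- The hexagons h_{i+1,1}, h_{i+1,2}, s_{i+1,1} (above), s_{i+1,2} (below).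

pyreneFragment : ℕ → List Point
pyreneFragment i =
    (4 * i     , 3)
  ∷ (4 * i + 2 , 3)
  ∷ (4 * i + 1 , 6)
  ∷ (4 * i + 1 , 0)
  ∷ []
  where open import Data.Nat using (_+_; _*_)

H : ℕ → Graph
H n = hexagonalSystem (concatMap pyreneFragment (upTo n))

-- The field ℚ(√2): a +√2· b stands for the real number a + b√2.  By
-- irrationality of √2 the coefficients are determined by the number, so _≡_
-- is equality of real numbers.

infix 3 _+√2·_

record ℚ⟨√2⟩ : Set where
  constructor _+√2·_
  field
    rat irr : ℚ

infixl 6 _+_ _-_
infixl 7 _*_ _/_
infixr 8 _^_

_+_ _-_ _*_ : ℚ⟨√2⟩ → ℚ⟨√2⟩ → ℚ⟨√2⟩
(a +√2· b) + (c +√2· d) = a ℚ.+ c +√2· b ℚ.+ d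
(a +√2· b) - (c +√2· d) = a ℚ.- c +√2· b ℚ.- d
(a +√2· b) * (c +√2· d) =
  a ℚ.* c ℚ.+ (+ 2 ℚ./ 1) ℚ.* (b ℚ.* d) +√2· a ℚ.* d ℚ.+ b ℚ.* c

ι : ℕ → ℚ⟨√2⟩
ι m = + m ℚ./ 1 +√2· 0ℚ

√2 : ℚ⟨√2⟩
√2 = 0ℚ +√2· 1ℚ

_/_ : ℚ⟨√2⟩ → (d : ℕ) → .{{NonZero d}} → ℚ⟨√2⟩
(a +√2· b) / d = a ℚ.* (+ 1 ℚ./ d) +√2· b ℚ.* (+ 1 ℚ./ d)

_^_ : ℚ⟨√2⟩ → ℕ → ℚ⟨√2⟩
z ^ zero  = ι 1
z ^ suc m = z * z ^ m

{-# OPTIONS --safe #-}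

-- Around a fragment, the outer hexagons s_{i,1} and s_{i,2} are joined by the
-- common edge of h_{i,1} and h_{i,2} (the "centre"), and the fragment meets its
-- neighbours in the remaining vertical edges of the row (the "borders").  Parity
-- leaves each fragment six states in a perfect matching: both outer hexagons are
-- alternating (four states), or the centre is used and the two edges to the left
-- border, or the two edges to the right border, are used as well.  The only
-- constraint is that a fragment going right is not followed by one going left.
--
-- The forcing number is 2 #(alternating) + #(centre used).  It is at most that:
-- the inner edges of the two outer hexagons, respectively an edge to the border,
-- determine the state.  It is at least that: rotating an outer hexagon,
-- respectively h_{i,1} or h_{i,2}, yields another perfect matching, and the edges
-- lost in these rotations are pairwise disjoint.
--
-- Summing over the words that avoid right-left is a two-state transfer
-- recursion; it is solved in terms of (3 + 2√2)^n = x + 2y√2.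

module Submission where

open import Defs
open import Data.Bool using (Bool; true; false; not; _∧_; _∨_; if_then_else_; T)
import Data.Bool.Properties as Boolₚ
open import Data.Empty using (⊥-elim)
open import Data.Integer as ℤ using (+_)
import Data.Integer.Properties as ℤₚ
open import Data.List using (List; []; _∷_; _++_; map; concatMap; filter; length; upTo)
open import Data.List.Extrema.Nat using (min≤v⁺; v≤min⁺)
import Data.List.Membership.DecPropositional as DecMembership
open import Data.List.Membership.Propositional using (_∈_; _∉_; find; lose)
open import Data.List.Membership.Propositional.Properties
open import Data.List.Membership.Propositional.Properties.WithK using (unique∧set⇒bag)
open import Data.List.Properties using (filter-accept; filter-reject; length-map; length-++; map-++; map-∘; map-cong-local; ∷-injectiveʳ)
open import Data.List.Relation.Binary.BagAndSetEquality using (∼bag⇒↭)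
open import Data.List.Relation.Binary.Permutation.Propositional using (_↭_)
open import Data.List.Relation.Binary.Permutation.Propositional.Properties using (↭-length; map⁺)
open import Data.List.Relation.Binary.Subset.Propositional using (_⊆_)
open import Data.List.Relation.Unary.All as All using (All; []; _∷_)
import Data.List.Relation.Unary.All.Properties as Allₚ
open import Data.List.Relation.Unary.AllPairs as AllPairs using ([]; _∷_)
import Data.List.Relation.Unary.AllPairs.Properties as AllPairsₚ
open import Data.List.Relation.Unary.Any using (here; there)
open import Data.List.Relation.Unary.Unique.Propositional using (Unique)
import Data.List.Relation.Unary.Unique.Propositional.Properties as Uniqueₚ
open import Data.Maybe using (Maybe; just; nothing; is-just; maybe)
open import Data.Nat as ℕ using (ℕ; zero; suc)
import Data.Nat.DivMod as DivMod
open import Data.Nat.Divisibility using (divides)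
open import Data.Nat.ListAction using (sum)
open import Data.Nat.ListAction.Properties using (sum-↭; sum-++)
import Data.Nat.Properties as ℕₚ
open import Data.Nat.Tactic.RingSolver using (solve-∀)
open import Data.Product using (∃-syntax; _×_; _,_; proj₁; proj₂)
open import Data.Rational as ℚ using (ℚ; 0ℚ)
import Data.Rational.Properties as ℚₚ
open import Data.Rational.Solver renaming (module +-*-Solver to ℚ-Solver)
import Data.Rational.Unnormalised as ℚᵘ
import Data.Rational.Unnormalised.Properties as ℚᵘₚ
open import Data.Sum as Sum using (_⊎_; inj₁; inj₂)
open import Data.Unit using (⊤; tt)
open import Data.Vec as Vec using (Vec; []; _∷_)
import Data.Vec.Properties as Vecₚ
open import Function using (_∘_; mk⇔)
open import Relation.Binary.PropositionalEquality using (_≡_; _≢_; _≗_; refl; sym; trans; cong; cong₂; subst; module ≡-Reasoning)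
open import Relation.Nullary using (¬_; Dec; does; yes; no)
open import Relation.Unary using (Decidable)

module _ {A : Set} where

  unique-⊆⇒length≤ : ∀ {xs ys : List A} → Unique xs → xs ⊆ ys → length xs ℕ.≤ length ys
  unique-⊆⇒length≤ {[]} _ _ = ℕ.z≤n
  unique-⊆⇒length≤ {x ∷ xs} {ys} u@(_ ∷ u′) s with ∈-∃++ (s (here refl))
  ... | ps , qs , refl = begin
    suc (length xs)                  ≤⟨ ℕ.s≤s (unique-⊆⇒length≤ u′ rest) ⟩
    suc (length (ps ++ qs))          ≡⟨ cong suc (length-++ ps) ⟩
    suc (length ps ℕ.+ length qs)    ≡⟨ ℕₚ.+-suc (length ps) (length qs) ⟨
    length ps ℕ.+ suc (length qs)    ≡⟨ length-++ ps ⟨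
    length (ps ++ x ∷ qs)            ∎
    where
    open ℕₚ.≤-Reasoning
    rest : xs ⊆ ps ++ qs
    rest y∈xs with ∈-++⁻ ps (s (there y∈xs))
    ... | inj₁ p             = ∈-++⁺ˡ p
    ... | inj₂ (here refl)   = ⊥-elim (Uniqueₚ.Unique[x∷xs]⇒x∉xs u y∈xs)
    ... | inj₂ (there q)     = ∈-++⁺ʳ ps q

  unique-sameElements⇒↭ : ∀ {xs ys : List A} → Unique xs → Unique ys → xs ⊆ ys → ys ⊆ xs → xs ↭ ys
  unique-sameElements⇒↭ u v s t = ∼bag⇒↭ (unique∧set⇒bag u v (mk⇔ s t))

  ∈-subsets⇒⊆ : ∀ {M} (xs : List A) → M ∈ subsets xs → M ⊆ xs
  ∈-subsets⇒⊆ [] (here refl) ()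
  ∈-subsets⇒⊆ (x ∷ xs) p q with ∈-++⁻ (map (x ∷_) (subsets xs)) p
  ... | inj₂ r = there (∈-subsets⇒⊆ xs r q)
  ... | inj₁ r with ∈-map⁻ (x ∷_) r
  ... | _ , M′∈ , refl with q
  ... | here refl = here refl
  ... | there q′  = there (∈-subsets⇒⊆ xs M′∈ q′)

  subsets-unique : ∀ {xs : List A} → Unique xs → Unique (subsets xs)
  subsets-unique [] = [] ∷ []
  subsets-unique {x ∷ xs} u@(_ ∷ u′) =
    Uniqueₚ.++⁺ (Uniqueₚ.map⁺ ∷-injectiveʳ (subsets-unique u′)) (subsets-unique u′) disjoint
    where
    disjoint : ∀ {M} → ¬ (M ∈ map (x ∷_) (subsets xs) × M ∈ subsets xs)
    disjoint (p , q) with ∈-map⁻ (x ∷_) p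
    ... | _ , _ , refl = Uniqueₚ.Unique[x∷xs]⇒x∉xs u (∈-subsets⇒⊆ xs q (here refl))

  module _ {P : A → Set} (P? : Decidable P) where

    filter-∈-subsets : ∀ xs → filter P? xs ∈ subsets xs
    filter-∈-subsets [] = here refl
    filter-∈-subsets (x ∷ xs) with P? x
    ... | yes _ = ∈-++⁺ˡ (∈-map⁺ (x ∷_) (filter-∈-subsets xs))
    ... | no  _ = ∈-++⁺ʳ _ (filter-∈-subsets xs)

    subset≡filter : ∀ {M xs} → Unique xs → M ∈ subsets xs →
                    (∀ {x} → x ∈ xs → x ∈ M → P x) → (∀ {x} → x ∈ xs → P x → x ∈ M) →
                    M ≡ filter P? xs
    subset≡filter {xs = []} _ (here refl) _ _ = refl
    subset≡filter {M} {x ∷ xs} u@(_ ∷ u′) M∈ to from with ∈-++⁻ (map (x ∷_) (subsets xs)) M∈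
    ... | inj₂ r = trans (subset≡filter u′ r (to ∘ there) (from ∘ there))
                         (sym (filter-reject P? (x∉M ∘ from (here refl))))
      where
      x∉M : x ∉ M
      x∉M = Uniqueₚ.Unique[x∷xs]⇒x∉xs u ∘ ∈-subsets⇒⊆ xs r
    ... | inj₁ r with ∈-map⁻ (x ∷_) r
    ... | M′ , M′∈ , refl = trans
      (cong (x ∷_) (subset≡filter u′ M′∈ (λ p → to (there p) ∘ there) from′))
      (sym (filter-accept P? (to (here refl) (here refl))))
      where
      from′ : ∀ {y} → y ∈ xs → P y → y ∈ M′
      from′ y∈ Py with from (there y∈) Py
      ... | here refl = ⊥-elim (Uniqueₚ.Unique[x∷xs]⇒x∉xs u y∈)
      ... | there q   = q

  subset-unique : ∀ {M xs : List A} → (∀ (x y : A) → Dec (x ≡ y)) → Unique xs → M ∈ subsets xs → Unique M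
  subset-unique {M} {xs} _≟_ u M∈ = subst Unique
    (sym (subset≡filter (_∈? M) u M∈ (λ _ p → p) (λ _ p → p))) (Uniqueₚ.filter⁺ (_∈? M) u)
    where open DecMembership _≟_ using (_∈?_)

-- Names for the vertices and edges of the pyrene system, mirror symmetric in the
-- horizontal axis: `far`, ..., `near` are the vertices of an outer hexagon by
-- their distance from the axis, and `corner i`, `border i` lie between the
-- fragments i - 1 and i.
data Side : Set where
  lo hi : Side

data Node : Set where
  far farL farR nearL nearR near : Node

data Link : Set where
  outerL outerR sideL sideR innerL innerR spokeL spokeR : Link

data Vertex : Set where
  node   : ℕ → Side → Node → Vertex
  corner : ℕ → Side → Vertex

data Edge : Set where
  link          : ℕ → Side → Link → Edge
  centre border : ℕ → Edge

column : Node → ℕ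
column far   = 2
column farL  = 1
column farR  = 3
column nearL = 1
column nearR = 3
column near  = 2

row : Side → Node → ℕ
row lo far   = 0
row lo farL  = 1
row lo farR  = 1
row lo nearL = 3
row lo nearR = 3
row lo near  = 4
row hi far   = 10
row hi farL  = 9
row hi farR  = 9
row hi nearL = 7
row hi nearR = 7
row hi near  = 6

point : Vertex → Point
point (node i σ k)  = 4 ℕ.* i ℕ.+ column k , row σ k
point (corner i lo) = 4 ℕ.* i , 4
point (corner i hi) = 4 ℕ.* i , 6

-- The edges of an outer hexagon from their end farther from the axis: they point
-- upwards on the lower side and downwards on the upper side.
inwards : ℕ → Side → Link → Vertex × Vertex
inwards i σ outerL = node i σ far   , node i σ farL
inwards i σ outerR = node i σ far   , node i σ farR
inwards i σ sideL  = node i σ farL  , node i σ nearL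
inwards i σ sideR  = node i σ farR  , node i σ nearR
inwards i σ innerL = node i σ nearL , node i σ near
inwards i σ innerR = node i σ nearR , node i σ near
inwards i σ spokeL = node i σ nearL , corner i σ
inwards i σ spokeR = node i σ nearR , corner (suc i) σ

lower upper : Edge → Vertex
lower (link i lo e) = proj₁ (inwards i lo e)
lower (link i hi e) = proj₂ (inwards i hi e)
lower (centre i)    = node i lo near
lower (border i)    = corner i lo
upper (link i lo e) = proj₂ (inwards i lo e)
upper (link i hi e) = proj₁ (inwards i hi e)
upper (centre i)    = node i hi near
upper (border i)    = corner i hi

segment : Edge → Point × Point
segment e = point (lower e) , point (upper e)

vertexAt : ℕ → ℕ → ℕ → Vertex
vertexAt q 0 4  = corner q lo
vertexAt q 0 6  = corner q hi
vertexAt q 2 0  = node q lo far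
vertexAt q 1 1  = node q lo farL
vertexAt q 3 1  = node q lo farR
vertexAt q 1 3  = node q lo nearL
vertexAt q 3 3  = node q lo nearR
vertexAt q 2 4  = node q lo near
vertexAt q 2 10 = node q hi far
vertexAt q 1 9  = node q hi farL
vertexAt q 3 9  = node q hi farR
vertexAt q 1 7  = node q hi nearL
vertexAt q 3 7  = node q hi nearR
vertexAt q _ _  = node q hi near

vertexOf : Point → Vertex
vertexOf (x , y) = vertexAt (x DivMod./ 4) (x DivMod.% 4) y

quotient : ∀ i {r} → r ℕ.< 4 → (4 ℕ.* i ℕ.+ r) DivMod./ 4 ≡ i
quotient i {r} r<4 = begin
  (4 ℕ.* i ℕ.+ r) DivMod./ 4               ≡⟨ DivMod.+-distrib-/-∣ˡ {4 ℕ.* i} r (divides i (ℕₚ.*-comm 4 i)) ⟩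
  4 ℕ.* i DivMod./ 4 ℕ.+ r DivMod./ 4      ≡⟨ cong₂ ℕ._+_ (trans (cong (DivMod._/ 4) (ℕₚ.*-comm 4 i)) (DivMod.m*n/n≡m i 4)) (DivMod.m<n⇒m/n≡0 r<4) ⟩
  i ℕ.+ 0                                  ≡⟨ ℕₚ.+-identityʳ i ⟩
  i                                        ∎
  where open ≡-Reasoning

remainder : ∀ i {r} → r ℕ.< 4 → (4 ℕ.* i ℕ.+ r) DivMod.% 4 ≡ r
remainder i {r} r<4 = begin
  (4 ℕ.* i ℕ.+ r) DivMod.% 4   ≡⟨ cong (DivMod._% 4) (trans (ℕₚ.+-comm (4 ℕ.* i) r) (cong (r ℕ.+_) (ℕₚ.*-comm 4 i))) ⟩
  (r ℕ.+ i ℕ.* 4) DivMod.% 4   ≡⟨ DivMod.[m+kn]%n≡m%n r i 4 ⟩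
  r DivMod.% 4                 ≡⟨ DivMod.m<n⇒m%n≡m r<4 ⟩
  r                            ∎
  where open ≡-Reasoning

vertexOf-point : ∀ v → vertexOf (point v) ≡ v
vertexOf-point (node i σ k) =
  trans (cong₂ (λ q r → vertexAt q r (row σ k)) (quotient i (c<4 k)) (remainder i (c<4 k))) (table σ k)
  where
  c<4 : ∀ k → column k ℕ.< 4
  c<4 far   = ℕ.s≤s (ℕ.s≤s (ℕ.s≤s ℕ.z≤n))
  c<4 farL  = ℕ.s≤s (ℕ.s≤s ℕ.z≤n)
  c<4 farR  = ℕ.s≤s (ℕ.s≤s (ℕ.s≤s (ℕ.s≤s ℕ.z≤n)))
  c<4 nearL = ℕ.s≤s (ℕ.s≤s ℕ.z≤n)
  c<4 nearR = ℕ.s≤s (ℕ.s≤s (ℕ.s≤s (ℕ.s≤s ℕ.z≤n)))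
  c<4 near  = ℕ.s≤s (ℕ.s≤s (ℕ.s≤s ℕ.z≤n))
  table : ∀ {q} σ k → vertexAt q (column k) (row σ k) ≡ node q σ k
  table lo far   = refl
  table lo farL  = refl
  table lo farR  = refl
  table lo nearL = refl
  table lo nearR = refl
  table lo near  = refl
  table hi far   = refl
  table hi farL  = refl
  table hi farR  = refl
  table hi nearL = refl
  table hi nearR = refl
  table hi near  = refl
vertexOf-point (corner i σ) = trans (shift σ) (trans
  (cong₂ (λ q r → vertexAt q r (y σ)) (quotient i (ℕ.s≤s ℕ.z≤n)) (remainder i (ℕ.s≤s ℕ.z≤n))) (table σ))
  where
  y : Side → ℕ
  y lo = 4
  y hi = 6
  shift : ∀ σ → vertexOf (point (corner i σ)) ≡ vertexOf (4 ℕ.* i ℕ.+ 0 , y σ)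
  shift lo = cong (λ x → vertexOf (x , 4)) (sym (ℕₚ.+-identityʳ (4 ℕ.* i)))
  shift hi = cong (λ x → vertexOf (x , 6)) (sym (ℕₚ.+-identityʳ (4 ℕ.* i)))
  table : ∀ {q} σ → vertexAt q 0 (y σ) ≡ corner q σ
  table lo = refl
  table hi = refl

point-injective : ∀ {u v} → point u ≡ point v → u ≡ v
point-injective {u} {v} eq = trans (sym (vertexOf-point u)) (trans (cong vertexOf eq) (vertexOf-point v))

linkBetween : Node → Node → Link
linkBetween far   farL  = outerL
linkBetween far   farR  = outerR
linkBetween farL  _     = sideL
linkBetween farR  _     = sideR
linkBetween nearL _     = innerL
linkBetween _     _     = innerR

spoke : Node → Link
spoke nearL = spokeL
spoke _     = spokeR

edgeBetween : Vertex → Vertex → Edge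
edgeBetween (node i lo k)  (node _ lo l) = link i lo (linkBetween k l)
edgeBetween (node _ hi k)  (node i hi l) = link i hi (linkBetween l k)
edgeBetween (node i _ _)   (node _ _ _)  = centre i
edgeBetween (node i σ k)   (corner _ _)  = link i σ (spoke k)
edgeBetween (corner _ _)   (node i σ k)  = link i σ (spoke k)
edgeBetween (corner i _)   (corner _ _)  = border i

edgeOf : Point × Point → Edge
edgeOf (p , q) = edgeBetween (vertexOf p) (vertexOf q)

edgeOf-segment : ∀ e → edgeOf (segment e) ≡ e
edgeOf-segment e =
  trans (cong₂ edgeBetween (vertexOf-point (lower e)) (vertexOf-point (upper e))) (table e)
  where
  table : ∀ e → edgeBetween (lower e) (upper e) ≡ e
  table (link i lo outerL) = refl
  table (link i lo outerR) = refl
  table (link i lo sideL)  = refl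
  table (link i lo sideR)  = refl
  table (link i lo innerL) = refl
  table (link i lo innerR) = refl
  table (link i lo spokeL) = refl
  table (link i lo spokeR) = refl
  table (link i hi outerL) = refl
  table (link i hi outerR) = refl
  table (link i hi sideL)  = refl
  table (link i hi sideR)  = refl
  table (link i hi innerL) = refl
  table (link i hi innerR) = refl
  table (link i hi spokeL) = refl
  table (link i hi spokeR) = refl
  table (centre i)         = refl
  table (border i)         = refl

fragmentEdges : ℕ → List Edge
fragmentEdges i =
    link i lo spokeL ∷ link i lo innerL ∷ border i ∷ centre i ∷ link i hi spokeL ∷ link i hi innerL
  ∷ link i lo innerR ∷ link i lo spokeR ∷ centre i ∷ border (suc i) ∷ link i hi innerR ∷ link i hi spokeR
  ∷ link i hi innerL ∷ link i hi innerR ∷ link i hi sideL ∷ link i hi sideR ∷ link i hi outerL ∷ link i hi outerR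
  ∷ link i lo outerL ∷ link i lo outerR ∷ link i lo sideL ∷ link i lo sideR ∷ link i lo innerL ∷ link i lo innerR
  ∷ []

fragmentVertices : ℕ → List Vertex
fragmentVertices i =
    node i lo nearL ∷ corner i lo ∷ node i lo near ∷ corner i hi ∷ node i hi near ∷ node i hi nearL
  ∷ node i lo nearR ∷ node i lo near ∷ corner (suc i) lo ∷ node i hi near ∷ corner (suc i) hi ∷ node i hi nearR
  ∷ node i hi near ∷ node i hi nearL ∷ node i hi nearR ∷ node i hi farL ∷ node i hi farR ∷ node i hi far
  ∷ node i lo far ∷ node i lo farL ∷ node i lo farR ∷ node i lo nearL ∷ node i lo nearR ∷ node i lo near
  ∷ []

next : ∀ i → 4 ℕ.* i ℕ.+ 2 ℕ.+ 2 ≡ 4 ℕ.* suc i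
next i = trans (ℕₚ.+-assoc (4 ℕ.* i) 2 2) (trans (ℕₚ.+-comm (4 ℕ.* i) 4) (sym (ℕₚ.*-suc 4 i)))

fragment-edges : ∀ i → concatMap Hexagon.edges (pyreneFragment i) ≡ map segment (fragmentEdges i)
fragment-edges i
  rewrite sym (next i) | ℕₚ.+-assoc (4 ℕ.* i) 2 1 | ℕₚ.+-assoc (4 ℕ.* i) 1 1 | ℕₚ.+-assoc (4 ℕ.* i) 1 2 = refl

fragment-vertices : ∀ i → concatMap Hexagon.vertices (pyreneFragment i) ≡ map point (fragmentVertices i)
fragment-vertices i
  rewrite sym (next i) | ℕₚ.+-assoc (4 ℕ.* i) 2 1 | ℕₚ.+-assoc (4 ℕ.* i) 1 1 | ℕₚ.+-assoc (4 ℕ.* i) 1 2 = refl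

Inside : ℕ → Edge → Set
Inside n (link i _ _)     = i ℕ.< n
Inside n (centre i)       = i ℕ.< n
Inside n (border zero)    = 0 ℕ.< n
Inside n (border (suc i)) = i ℕ.< n

InsideV : ℕ → Vertex → Set
InsideV n (node i _ _)       = i ℕ.< n
InsideV n (corner zero _)    = 0 ℕ.< n
InsideV n (corner (suc i) _) = i ℕ.< n

module _ {B : Set} (f : Point → List B) where

  ∈-fragments⁺ : ∀ {n i b} → i ℕ.< n → b ∈ concatMap f (pyreneFragment i) →
                 b ∈ concatMap f (concatMap pyreneFragment (upTo n))
  ∈-fragments⁺ {n} {i} i<n b∈ with find (∈-concatMap⁻ f {xs = pyreneFragment i} b∈)
  ... | _ , h∈ , b∈h = ∈-concatMap⁺ f (lose (∈-concatMap⁺ pyreneFragment (lose (∈-upTo⁺ i<n) h∈)) b∈h)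

  ∈-fragments⁻ : ∀ n {b} → b ∈ concatMap f (concatMap pyreneFragment (upTo n)) →
                 ∃[ i ] i ℕ.< n × b ∈ concatMap f (pyreneFragment i)
  ∈-fragments⁻ n b∈ with find (∈-concatMap⁻ f {xs = concatMap pyreneFragment (upTo n)} b∈)
  ... | _ , h∈ , b∈h with find (∈-concatMap⁻ pyreneFragment {xs = upTo n} h∈)
  ... | i , i∈ , h∈i = i , ∈-upTo⁻ i∈ , ∈-concatMap⁺ f (lose h∈i b∈h)

border-inside : ∀ {n} i → i ℕ.< n → Inside n (border i)
border-inside zero    i<n = i<n
border-inside (suc i) i<n = ℕₚ.<⇒≤ i<n

corner-inside : ∀ {n} i σ → i ℕ.< n → InsideV n (corner i σ)
corner-inside zero    _ i<n = i<n
corner-inside (suc i) _ i<n = ℕₚ.<⇒≤ i<n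

fragmentEdges-inside : ∀ {n i} → i ℕ.< n → All (Inside n) (fragmentEdges i)
fragmentEdges-inside {i = i} p =
    p ∷ p ∷ border-inside i p ∷ p ∷ p ∷ p ∷ p ∷ p ∷ p ∷ p ∷ p ∷ p
  ∷ p ∷ p ∷ p ∷ p ∷ p ∷ p ∷ p ∷ p ∷ p ∷ p ∷ p ∷ p ∷ []

fragmentVertices-inside : ∀ {n i} → i ℕ.< n → All (InsideV n) (fragmentVertices i)
fragmentVertices-inside {i = i} p =
    p ∷ corner-inside i lo p ∷ p ∷ corner-inside i hi p ∷ p ∷ p ∷ p ∷ p ∷ p ∷ p ∷ p ∷ p
  ∷ p ∷ p ∷ p ∷ p ∷ p ∷ p ∷ p ∷ p ∷ p ∷ p ∷ p ∷ p ∷ []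

pattern #0 = here refl
pattern #1 = there #0
pattern #2 = there #1
pattern #3 = there #2
pattern #6+ p = there (there (there (there (there (there p)))))

inside-fragmentEdges : ∀ {n} e → Inside n e → ∃[ i ] i ℕ.< n × e ∈ fragmentEdges i
inside-fragmentEdges (link i lo outerL) p = i , p , #6+ (#6+ (#6+ #0))
inside-fragmentEdges (link i lo outerR) p = i , p , #6+ (#6+ (#6+ #1))
inside-fragmentEdges (link i lo sideL)  p = i , p , #6+ (#6+ (#6+ #2))
inside-fragmentEdges (link i lo sideR)  p = i , p , #6+ (#6+ (#6+ #3))
inside-fragmentEdges (link i lo innerL) p = i , p , #1
inside-fragmentEdges (link i lo innerR) p = i , p , #6+ #0
inside-fragmentEdges (link i lo spokeL) p = i , p , #0
inside-fragmentEdges (link i lo spokeR) p = i , p , #6+ #1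
inside-fragmentEdges (link i hi outerL) p = i , p , #6+ (#6+ (there #3))
inside-fragmentEdges (link i hi outerR) p = i , p , #6+ (#6+ (there (there #3)))
inside-fragmentEdges (link i hi sideL)  p = i , p , #6+ (#6+ #2)
inside-fragmentEdges (link i hi sideR)  p = i , p , #6+ (#6+ #3)
inside-fragmentEdges (link i hi innerL) p = i , p , #6+ (#6+ #0)
inside-fragmentEdges (link i hi innerR) p = i , p , #6+ (#6+ #1)
inside-fragmentEdges (link i hi spokeL) p = i , p , there #3
inside-fragmentEdges (link i hi spokeR) p = i , p , #6+ (there (there #3))
inside-fragmentEdges (centre i)         p = i , p , #3
inside-fragmentEdges (border zero)      p = 0 , p , #2
inside-fragmentEdges (border (suc i))   p = i , p , #6+ #3

inside-fragmentVertices : ∀ {n} v → InsideV n v → ∃[ i ] i ℕ.< n × v ∈ fragmentVertices i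
inside-fragmentVertices (node i lo far)    p = i , p , #6+ (#6+ (#6+ #0))
inside-fragmentVertices (node i lo farL)   p = i , p , #6+ (#6+ (#6+ #1))
inside-fragmentVertices (node i lo farR)   p = i , p , #6+ (#6+ (#6+ #2))
inside-fragmentVertices (node i lo nearL)  p = i , p , #0
inside-fragmentVertices (node i lo nearR)  p = i , p , #6+ #0
inside-fragmentVertices (node i lo near)   p = i , p , #2
inside-fragmentVertices (node i hi far)    p = i , p , #6+ (#6+ (there (there #3)))
inside-fragmentVertices (node i hi farL)   p = i , p , #6+ (#6+ #3)
inside-fragmentVertices (node i hi farR)   p = i , p , #6+ (#6+ (there #3))
inside-fragmentVertices (node i hi nearL)  p = i , p , #6+ (#6+ #1)
inside-fragmentVertices (node i hi nearR)  p = i , p , #6+ (#6+ #2)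
inside-fragmentVertices (node i hi near)   p = i , p , #6+ (#6+ #0)
inside-fragmentVertices (corner zero lo)   p = 0 , p , #1
inside-fragmentVertices (corner zero hi)   p = 0 , p , #3
inside-fragmentVertices (corner (suc i) lo) p = i , p , #6+ #2
inside-fragmentVertices (corner (suc i) hi) p = i , p , #6+ (there #3)

module _ (n : ℕ) where
  open Graph (H n) using (_≟ᴱ_)

  private
    hexagons = concatMap pyreneFragment (upTo n)

  ∈-edges⁻ : ∀ {s} → s ∈ Graph.edges (H n) → ∃[ e ] Inside n e × s ≡ segment e
  ∈-edges⁻ {s} s∈ = named (∈-fragments⁻ Hexagon.edges n (∈-deduplicate⁻ _≟ᴱ_ (concatMap Hexagon.edges hexagons) s∈))
    where
    named : (∃[ i ] i ℕ.< n × s ∈ concatMap Hexagon.edges (pyreneFragment i)) → ∃[ e ] Inside n e × s ≡ segment e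
    named (i , i<n , s∈i) =
      let e , e∈ , eq = ∈-map⁻ segment {xs = fragmentEdges i} (subst (s ∈_) (fragment-edges i) s∈i)
      in e , All.lookup (fragmentEdges-inside i<n) e∈ , eq

  ∈-edges⁺ : ∀ e → Inside n e → segment e ∈ Graph.edges (H n)
  ∈-edges⁺ e p = let i , i<n , e∈ = inside-fragmentEdges e p in
    ∈-deduplicate⁺ _≟ᴱ_ {xs = concatMap Hexagon.edges hexagons}
      (∈-fragments⁺ Hexagon.edges i<n (subst (segment e ∈_) (sym (fragment-edges i)) (∈-map⁺ segment e∈)))

  ∈-vertices⁻ : ∀ {s} → s ∈ Graph.vertices (H n) → ∃[ v ] InsideV n v × s ≡ point v
  ∈-vertices⁻ {s} s∈ = named (∈-fragments⁻ Hexagon.vertices n (∈-deduplicate⁻ _≟ᴾ_ (concatMap Hexagon.vertices hexagons) s∈))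
    where
    named : (∃[ i ] i ℕ.< n × s ∈ concatMap Hexagon.vertices (pyreneFragment i)) → ∃[ v ] InsideV n v × s ≡ point v
    named (i , i<n , s∈i) =
      let v , v∈ , eq = ∈-map⁻ point {xs = fragmentVertices i} (subst (s ∈_) (fragment-vertices i) s∈i)
      in v , All.lookup (fragmentVertices-inside i<n) v∈ , eq

  ∈-vertices⁺ : ∀ v → InsideV n v → point v ∈ Graph.vertices (H n)
  ∈-vertices⁺ v p = let i , i<n , v∈ = inside-fragmentVertices v p in
    ∈-deduplicate⁺ _≟ᴾ_ {xs = concatMap Hexagon.vertices hexagons}
      (∈-fragments⁺ Hexagon.vertices i<n (subst (point v ∈_) (sym (fragment-vertices i)) (∈-map⁺ point v∈)))

star : Vertex → List Edge
star (node i σ far)     = link i σ outerL ∷ link i σ outerR ∷ []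
star (node i σ farL)    = link i σ outerL ∷ link i σ sideL ∷ []
star (node i σ farR)    = link i σ outerR ∷ link i σ sideR ∷ []
star (node i σ nearL)   = link i σ sideL ∷ link i σ innerL ∷ link i σ spokeL ∷ []
star (node i σ nearR)   = link i σ sideR ∷ link i σ innerR ∷ link i σ spokeR ∷ []
star (node i σ near)    = link i σ innerL ∷ link i σ innerR ∷ centre i ∷ []
star (corner zero σ)    = border 0 ∷ link 0 σ spokeL ∷ []
star (corner (suc i) σ) = border (suc i) ∷ link (suc i) σ spokeL ∷ link i σ spokeR ∷ []

star-unique : ∀ v → Unique (star v)
star-unique (node i σ far)     = ((λ ()) ∷ []) ∷ [] ∷ []
star-unique (node i σ farL)    = ((λ ()) ∷ []) ∷ [] ∷ []
star-unique (node i σ farR)    = ((λ ()) ∷ []) ∷ [] ∷ []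
star-unique (node i σ nearL)   = ((λ ()) ∷ (λ ()) ∷ []) ∷ ((λ ()) ∷ []) ∷ [] ∷ []
star-unique (node i σ nearR)   = ((λ ()) ∷ (λ ()) ∷ []) ∷ ((λ ()) ∷ []) ∷ [] ∷ []
star-unique (node i σ near)    = ((λ ()) ∷ (λ ()) ∷ []) ∷ ((λ ()) ∷ []) ∷ [] ∷ []
star-unique (corner zero σ)    = ((λ ()) ∷ []) ∷ [] ∷ []
star-unique (corner (suc i) σ) = ((λ ()) ∷ (λ ()) ∷ []) ∷ ((λ ()) ∷ []) ∷ [] ∷ []

inwards-star : ∀ i σ l → link i σ l ∈ star (proj₁ (inwards i σ l)) × link i σ l ∈ star (proj₂ (inwards i σ l))
inwards-star i σ outerL       = #0 , #0
inwards-star i σ outerR       = #1 , #0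
inwards-star i σ sideL        = #1 , #0
inwards-star i σ sideR        = #1 , #0
inwards-star i σ innerL       = #1 , #0
inwards-star i σ innerR       = #1 , #1
inwards-star zero σ spokeL    = #2 , #1
inwards-star (suc i) σ spokeL = #2 , #1
inwards-star i σ spokeR       = #2 , #2

lower-star : ∀ e → e ∈ star (lower e)
lower-star (link i lo l)    = proj₁ (inwards-star i lo l)
lower-star (link i hi l)    = proj₂ (inwards-star i hi l)
lower-star (centre i)       = #2
lower-star (border zero)    = #0
lower-star (border (suc i)) = #0

upper-star : ∀ e → e ∈ star (upper e)
upper-star (link i lo l)    = proj₂ (inwards-star i lo l)
upper-star (link i hi l)    = proj₁ (inwards-star i hi l)
upper-star (centre i)       = #2
upper-star (border zero)    = #0
upper-star (border (suc i)) = #0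

End : Vertex → Edge → Set
End v e = v ≡ lower e ⊎ v ≡ upper e

first : ∀ {i v l} σ → v ≡ proj₁ (inwards i σ l) → End v (link i σ l)
first lo = inj₁
first hi = inj₂

second : ∀ {i v l} σ → v ≡ proj₂ (inwards i σ l) → End v (link i σ l)
second lo = inj₂
second hi = inj₁

star-end : ∀ v → All (End v) (star v)
star-end (node i σ far)     = first σ refl ∷ first σ refl ∷ []
star-end (node i σ farL)    = second σ refl ∷ first σ refl ∷ []
star-end (node i σ farR)    = second σ refl ∷ first σ refl ∷ []
star-end (node i σ nearL)   = second σ refl ∷ first σ refl ∷ first σ refl ∷ []
star-end (node i σ nearR)   = second σ refl ∷ first σ refl ∷ first σ refl ∷ []
star-end (node i lo near)   = inj₂ refl ∷ inj₂ refl ∷ inj₁ refl ∷ []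
star-end (node i hi near)   = inj₁ refl ∷ inj₁ refl ∷ inj₂ refl ∷ []
star-end (corner zero lo)   = inj₁ refl ∷ inj₂ refl ∷ []
star-end (corner zero hi)   = inj₂ refl ∷ inj₁ refl ∷ []
star-end (corner (suc i) lo) = inj₁ refl ∷ inj₂ refl ∷ inj₂ refl ∷ []
star-end (corner (suc i) hi) = inj₂ refl ∷ inj₁ refl ∷ inj₁ refl ∷ []

bit : Bool → ℕ
bit true  = 1
bit false = 0

count : (Edge → Bool) → List Edge → ℕ
count p []       = 0
count p (e ∷ es) = bit (p e) ℕ.+ count p es

count≡length-filter : ∀ p es → count p es ≡ length (filter (λ e → p e Boolₚ.≟ true) es)
count≡length-filter p [] = refl
count≡length-filter p (e ∷ es) with p e
... | true  = cong suc (count≡length-filter p es)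
... | false = count≡length-filter p es

does-true : ∀ {P : Set} (d : Dec P) → P → does d ≡ true
does-true (yes _) _ = refl
does-true (no ¬p) p = ⊥-elim (¬p p)

true-does : ∀ {P : Set} (d : Dec P) → does d ≡ true → P
true-does (yes p) _ = p

degree≡length : ∀ (G : Graph) {M v} {es : List (Graph.Edge G)} → Unique M → Unique es →
                (∀ {e} → e ∈ M → Incident G v e → e ∈ es) → All (λ e → e ∈ M × Incident G v e) es →
                degree G M v ≡ length es
degree≡length G {M} {v} {es} uM ues to from = ↭-length (unique-sameElements⇒↭
  (Uniqueₚ.filter⁺ (incident? G v) uM) ues
  (λ e∈ → let e∈M , inc = ∈-filter⁻ (incident? G v) {xs = M} e∈ in to e∈M inc)
  (λ e∈ → let e∈M , inc = All.lookup from e∈ in ∈-filter⁺ (incident? G v) e∈M inc))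

-- All that the matching theory uses of H n; with G abstract, the coordinates and
-- the deduplicated lists never unfold.
record Presents (n : ℕ) (G : Graph) : Set where
  field
    place : Vertex → Graph.V G

  span : Edge → Graph.Edge G
  span e = place (lower e) , place (upper e)

  field
    name            : Graph.Edge G → Edge
    place-injective : ∀ {u v} → place u ≡ place v → u ≡ v
    name-span       : ∀ e → name (span e) ≡ e
    vertices⁺       : ∀ v → InsideV n v → place v ∈ Graph.vertices G
    vertices⁻       : ∀ {p} → p ∈ Graph.vertices G → ∃[ v ] InsideV n v × p ≡ place v
    edges⁺          : ∀ e → Inside n e → span e ∈ Graph.edges G
    edges⁻          : ∀ {s} → s ∈ Graph.edges G → ∃[ e ] Inside n e × s ≡ span e

H-presented : ∀ n → Presents n (H n)
H-presented n = record
  { place           = point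
  ; name            = edgeOf
  ; place-injective = point-injective
  ; name-span       = edgeOf-segment
  ; vertices⁺       = ∈-vertices⁺ n
  ; vertices⁻       = ∈-vertices⁻ n
  ; edges⁺          = ∈-edges⁺ n
  ; edges⁻          = ∈-edges⁻ n
  }

module _ {n : ℕ} (G : Graph) (presents : Presents n G) where
  open Graph G using (edges; edges-unique; _≟ᴱ_)
  open Presents presents
  open DecMembership _≟ᴱ_ using (_∈?_)

  span-injective : ∀ {e f} → span e ≡ span f → e ≡ f
  span-injective {e} {f} eq = trans (sym (name-span e)) (trans (cong name eq) (name-span f))

  incident⇒star : ∀ {v} e → Incident G (place v) (span e) → e ∈ star v
  incident⇒star e (inj₁ p) with refl ← place-injective p = lower-star e
  incident⇒star e (inj₂ p) with refl ← place-injective p = upper-star e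

  member : List (Graph.Edge G) → Edge → Bool
  member M e = does (span e ∈? M)

  module _ {M} (M∈ : M ∈ subsets edges) where

    member⇒inside : ∀ e → member M e ≡ true → Inside n e
    member⇒inside e p with f , q , eq ← edges⁻ (∈-subsets⇒⊆ edges M∈ (true-does (span e ∈? M) p))
      with refl ← span-injective {e} {f} eq = q

    degree≡count : ∀ v → degree G M (place v) ≡ count (member M) (star v)
    degree≡count v = trans
      (degree≡length G (subset-unique _≟ᴱ_ edges-unique M∈)
        (Uniqueₚ.map⁺ (λ {e} {f} → span-injective {e} {f}) (Uniqueₚ.filter⁺ member? (star-unique v))) to
        (Allₚ.map⁺ (All.tabulate from)))
      (trans (length-map span (filter member? (star v))) (sym (count≡length-filter (member M) (star v))))
      where
      member? : ∀ e → Dec (member M e ≡ true)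
      member? e = member M e Boolₚ.≟ true

      to : ∀ {s} → s ∈ M → Incident G (place v) s → s ∈ map span (filter member? (star v))
      to s∈M inc with e , _ , refl ← edges⁻ (∈-subsets⇒⊆ edges M∈ s∈M) =
        ∈-map⁺ span (∈-filter⁺ member? (incident⇒star e inc) (does-true (span e ∈? M) s∈M))

      from : ∀ {e} → e ∈ filter member? (star v) → span e ∈ M × Incident G (place v) (span e)
      from {e} e∈ = let e∈star , m = ∈-filter⁻ member? {xs = star v} e∈ in
        true-does (span e ∈? M) m ,
        Sum.map (cong place) (cong place) (All.lookup (star-end v) e∈star)

    perfect⇒count : IsPerfect G M → ∀ v → InsideV n v → count (member M) (star v) ≡ 1
    perfect⇒count pm v p = trans (sym (degree≡count v)) (All.lookup pm (vertices⁺ v p))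

    count⇒perfect : (∀ v → InsideV n v → count (member M) (star v) ≡ 1) → IsPerfect G M
    count⇒perfect c = All.tabulate λ s∈ → let v , p , eq = vertices⁻ s∈ in
      subst (λ s → degree G M s ≡ 1) (sym eq) (trans (degree≡count v) (c v p))

-- `bridge true` goes to the left border, `bridge false` to the right one.  The
-- Boolean of a hexagon tells whether it uses the far left edge (`outerL`).
data Letter : Set where
  hex    : Bool → Bool → Letter
  bridge : Bool → Letter

orientation : Letter → Side → Bool
orientation (hex a b)  lo = a
orientation (hex a b)  hi = b
orientation (bridge o) _  = o

bridged : Letter → Bool
bridged (hex _ _)  = false
bridged (bridge _) = true

hexagonLink : Bool → Bool → Link → Bool
hexagonLink c o outerL = o
hexagonLink c o outerR = not o
hexagonLink c o sideL  = not o
hexagonLink c o sideR  = o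
hexagonLink c o innerL = not c ∧ o
hexagonLink c o innerR = not c ∧ not o
hexagonLink c o spokeL = c ∧ o
hexagonLink c o spokeR = c ∧ not o

usesLink : Maybe Letter → Side → Link → Bool
usesLink nothing  _ _ = false
usesLink (just s) σ l = hexagonLink (bridged s) (orientation s σ) l

usesCentre : Maybe Letter → Bool
usesCentre nothing  = false
usesCentre (just s) = bridged s

leftward rightward : Maybe Letter → Bool
leftward  s = usesLink s lo spokeL
rightward s = usesLink s lo spokeR

usesBorder : Maybe Letter → Maybe Letter → Bool
usesBorder s t = (is-just s ∨ is-just t) ∧ (not (rightward s) ∧ not (leftward t))

Word : ℕ → Set
Word = Vec Letter

at : ∀ {n} → Word n → ℕ → Maybe Letter
at []      _       = nothing
at (s ∷ w) zero    = just s
at (s ∷ w) (suc i) = at w i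

uses : ∀ {n} → Word n → Edge → Bool
uses w (link i σ l)     = usesLink (at w i) σ l
uses w (centre i)       = usesCentre (at w i)
uses w (border zero)    = usesBorder nothing (at w 0)
uses w (border (suc i)) = usesBorder (at w i) (at w (suc i))

Admissible : ∀ {n} → Bool → Word n → Set
Admissible r []      = ⊤
Admissible r (s ∷ w) = r ∧ leftward (just s) ≡ false × Admissible (rightward (just s)) w

admissible⇒at : ∀ {n r} (w : Word n) → Admissible r w →
                ∀ i → rightward (at w i) ∧ leftward (at w (suc i)) ≡ false
admissible⇒at []           _             i       = refl
admissible⇒at (s ∷ [])     _             zero    = Boolₚ.∧-zeroʳ _
admissible⇒at (s ∷ t ∷ w)  (_ , a , _)   zero    = a
admissible⇒at (s ∷ w)      (_ , a)       (suc i) = admissible⇒at w a i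

at⇒admissible : ∀ {n r} (w : Word n) → r ∧ leftward (at w 0) ≡ false →
                (∀ i → rightward (at w i) ∧ leftward (at w (suc i)) ≡ false) → Admissible r w
at⇒admissible []      _ _ = tt
at⇒admissible (s ∷ w) p q = p , at⇒admissible w (q 0) (q ∘ suc)

at-inside : ∀ {n i} (w : Word n) → i ℕ.< n → ∃[ s ] at w i ≡ just s
at-inside {i = zero}  (s ∷ w) _         = s , refl
at-inside {i = suc i} (s ∷ w) (ℕ.s≤s p) = at-inside w p

inside-at : ∀ {n i s} (w : Word n) → at w i ≡ just s → i ℕ.< n
inside-at {i = zero}  (s ∷ w) _ = ℕ.s≤s ℕ.z≤n
inside-at {i = suc i} (s ∷ w) p = ℕ.s≤s (inside-at w p)

uses⇒inside : ∀ {n} (w : Word n) e → uses w e ≡ true → Inside n e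
uses⇒inside w (link i σ l) p with just s ← at w i in eq = inside-at w eq
uses⇒inside w (centre i)   p with just s ← at w i in eq = inside-at w eq
uses⇒inside w (border zero) p with just s ← at w 0 in eq = inside-at w eq
uses⇒inside w (border (suc i)) p with at w i in eq
... | just s = inside-at w eq
... | nothing with just t ← at w (suc i) in eq′ = ℕₚ.<⇒≤ (inside-at w eq′)

nodeCount : (Link → Bool) → Bool → Node → ℕ
nodeCount f c far   = bit (f outerL) ℕ.+ (bit (f outerR) ℕ.+ 0)
nodeCount f c farL  = bit (f outerL) ℕ.+ (bit (f sideL) ℕ.+ 0)
nodeCount f c farR  = bit (f outerR) ℕ.+ (bit (f sideR) ℕ.+ 0)
nodeCount f c nearL = bit (f sideL) ℕ.+ (bit (f innerL) ℕ.+ (bit (f spokeL) ℕ.+ 0))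
nodeCount f c nearR = bit (f sideR) ℕ.+ (bit (f innerR) ℕ.+ (bit (f spokeR) ℕ.+ 0))
nodeCount f c near  = bit (f innerL) ℕ.+ (bit (f innerR) ℕ.+ (bit c ℕ.+ 0))

count-node : ∀ m i σ k → count m (star (node i σ k)) ≡ nodeCount (m ∘ link i σ) (m (centre i)) k
count-node m i σ far   = refl
count-node m i σ farL  = refl
count-node m i σ farR  = refl
count-node m i σ nearL = refl
count-node m i σ nearR = refl
count-node m i σ near  = refl

nodeCount-hexagonLink : ∀ c o k → nodeCount (hexagonLink c o) c k ≡ 1
nodeCount-hexagonLink _     true  far   = refl
nodeCount-hexagonLink _     false far   = refl
nodeCount-hexagonLink _     true  farL  = refl
nodeCount-hexagonLink _     false farL  = refl
nodeCount-hexagonLink _     true  farR  = refl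
nodeCount-hexagonLink _     false farR  = refl
nodeCount-hexagonLink true  true  nearL = refl
nodeCount-hexagonLink true  false nearL = refl
nodeCount-hexagonLink false true  nearL = refl
nodeCount-hexagonLink false false nearL = refl
nodeCount-hexagonLink true  true  nearR = refl
nodeCount-hexagonLink true  false nearR = refl
nodeCount-hexagonLink false true  nearR = refl
nodeCount-hexagonLink false false nearR = refl
nodeCount-hexagonLink true  true  near  = refl
nodeCount-hexagonLink true  false near  = refl
nodeCount-hexagonLink false true  near  = refl
nodeCount-hexagonLink false false near  = refl

usesSpokeL-side : ∀ s σ → usesLink s σ spokeL ≡ leftward s
usesSpokeL-side nothing           _ = refl
usesSpokeL-side (just (hex _ _))  _ = refl
usesSpokeL-side (just (bridge _)) _ = refl

usesSpokeR-side : ∀ s σ → usesLink s σ spokeR ≡ rightward s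
usesSpokeR-side nothing           _ = refl
usesSpokeR-side (just (hex _ _))  _ = refl
usesSpokeR-side (just (bridge _)) _ = refl

cornerCount : ∀ s t → T (is-just s ∨ is-just t) → rightward s ∧ leftward t ≡ false →
              bit (usesBorder s t) ℕ.+ (bit (leftward t) ℕ.+ (bit (rightward s) ℕ.+ 0)) ≡ 1
cornerCount s t j p with true ← is-just s ∨ is-just t | rightward s | leftward t
... | true  | false = refl
... | false | true  = refl
... | false | false = refl

uses-perfect : ∀ {n} (w : Word n) → Admissible false w → ∀ v → InsideV n v → count (uses w) (star v) ≡ 1
uses-perfect w _ (node i σ k) p = trans (count-node (uses w) i σ k) counted
  where
  counted : nodeCount (usesLink (at w i) σ) (usesCentre (at w i)) k ≡ 1
  counted with s , eq ← at-inside w p rewrite eq = nodeCount-hexagonLink (bridged s) (orientation s σ) k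
uses-perfect w _ (corner zero σ) p
  with s , eq ← at-inside w p rewrite eq | usesSpokeL-side (just s) σ =
  cornerCount nothing (just s) tt refl
uses-perfect w a (corner (suc i) σ) p
  rewrite usesSpokeL-side (at w (suc i)) σ | usesSpokeR-side (at w i) σ =
  cornerCount (at w i) (at w (suc i)) occupied (admissible⇒at w a i)
  where
  occupied : T (is-just (at w i) ∨ is-just (at w (suc i)))
  occupied with s , eq ← at-inside w p rewrite eq = tt

bit-injective : ∀ {a b} → bit a ≡ bit b → a ≡ b
bit-injective {true}  {true}  _ = refl
bit-injective {false} {false} _ = refl

complement : ∀ {a b} → bit a ℕ.+ (bit b ℕ.+ 0) ≡ 1 → b ≡ not a
complement {true}  {false} _ = refl
complement {false} {true}  _ = refl

none : ∀ {a b} → suc (bit a ℕ.+ (bit b ℕ.+ 0)) ≡ 1 → a ≡ false × b ≡ false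
none {false} {false} _ = refl , refl

inner-forced : ∀ o c {x y p q} →
  bit (not o) ℕ.+ (bit x ℕ.+ (bit p ℕ.+ 0)) ≡ 1 → bit o ℕ.+ (bit y ℕ.+ (bit q ℕ.+ 0)) ≡ 1 →
  bit x ℕ.+ (bit y ℕ.+ (bit c ℕ.+ 0)) ≡ 1 →
  (x ≡ not c ∧ o × y ≡ not c ∧ not o) × (p ≡ c ∧ o × q ≡ c ∧ not o)
inner-forced true c {x} {y} {p} {q} h₁ h₂ h₃
  with refl , refl ← none {y} {q} h₂
  with refl ← complement {x} {p} h₁ with refl ← complement {x} {c} h₃ with x
... | true  = (refl , refl) , (refl , refl)
... | false = (refl , refl) , (refl , refl)
inner-forced false c {x} {y} {p} {q} h₁ h₂ h₃
  with refl , refl ← none {x} {p} h₁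
  with refl ← complement {y} {q} h₂ with refl ← complement {y} {c} h₃ with y
... | true  = (refl , refl) , (refl , refl)
... | false = (refl , refl) , (refl , refl)

hexagon-forced : ∀ f c → (∀ k → nodeCount f c k ≡ 1) → ∀ l → f l ≡ hexagonLink c (f outerL) l
hexagon-forced f c h = forced
  where
  r≡ : f outerR ≡ not (f outerL)
  r≡ = complement (h far)
  sl≡ : f sideL ≡ not (f outerL)
  sl≡ = complement (h farL)
  sr≡ : f sideR ≡ f outerL
  sr≡ = trans (complement (h farR)) (trans (cong not r≡) (Boolₚ.not-involutive _))
  inner = inner-forced (f outerL) c
    (subst (λ b → bit b ℕ.+ (bit (f innerL) ℕ.+ (bit (f spokeL) ℕ.+ 0)) ≡ 1) sl≡ (h nearL))
    (subst (λ b → bit b ℕ.+ (bit (f innerR) ℕ.+ (bit (f spokeR) ℕ.+ 0)) ≡ 1) sr≡ (h nearR))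
    (h near)
  forced : ∀ l → f l ≡ hexagonLink c (f outerL) l
  forced outerL = refl
  forced outerR = r≡
  forced sideL  = sl≡
  forced sideR  = sr≡
  forced innerL = proj₁ (proj₁ inner)
  forced innerR = proj₂ (proj₁ inner)
  forced spokeL = proj₁ (proj₂ inner)
  forced spokeR = proj₂ (proj₂ inner)

build : (ℕ → Letter) → ∀ n → Word n
build f zero    = []
build f (suc n) = f 0 ∷ build (f ∘ suc) n

at-build : ∀ f {n i} → i ℕ.< n → at (build f n) i ≡ just (f i)
at-build f {suc n} {zero}  _         = refl
at-build f {suc n} {suc i} (ℕ.s≤s p) = at-build (f ∘ suc) p

at-outside : ∀ {n i} (w : Word n) → ¬ i ℕ.< n → at w i ≡ nothing
at-outside {i = i} w i≮n with at w i in eq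
... | nothing = refl
... | just s  = ⊥-elim (i≮n (inside-at w eq))

spokeR-agree : ∀ c o o′ → c ∧ o ≡ c ∧ o′ → c ∧ not o ≡ c ∧ not o′
spokeR-agree true  o o′ eq = cong not eq
spokeR-agree false o o′ eq = refl

border-forced : ∀ {b} l r → bit b ℕ.+ (bit l ℕ.+ (bit r ℕ.+ 0)) ≡ 1 → b ≡ not r ∧ not l × r ∧ l ≡ false
border-forced {true}  false false _ = refl , refl
border-forced {false} true  false _ = refl , refl
border-forced {false} false true  _ = refl , refl

module _ {n} (m : Edge → Bool) (inside : ∀ e → m e ≡ true → Inside n e)
         (perfect : ∀ v → InsideV n v → count m (star v) ≡ 1) where

  private
    absent : ∀ e → ¬ Inside n e → m e ≡ false
    absent e ¬p = Boolₚ.¬-not (¬p ∘ inside e)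

    hexagon : ∀ i σ → i ℕ.< n → ∀ l → m (link i σ l) ≡ hexagonLink (m (centre i)) (m (link i σ outerL)) l
    hexagon i σ p = hexagon-forced (m ∘ link i σ) (m (centre i))
      (λ k → trans (sym (count-node m i σ k)) (perfect (node i σ k) p))

    spokesL-agree : ∀ i → i ℕ.< n → m (link i lo spokeL) ≡ m (link i hi spokeL)
    spokesR-agree : ∀ i → i ℕ.< n → m (link i lo spokeR) ≡ m (link i hi spokeR)

    spokesL-agree zero    p = trans (complement {m (border 0)} (perfect (corner 0 lo) p)) (sym (complement {m (border 0)} (perfect (corner 0 hi) p)))
    spokesL-agree (suc i) p = bit-injective (ℕₚ.+-cancelʳ-≡ (bit (m (link i lo spokeR)) ℕ.+ 0) _ _
      (ℕₚ.+-cancelˡ-≡ (bit (m (border (suc i)))) _ _ (trans (perfect (corner (suc i) lo) (ℕₚ.<⇒≤ p))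
      (trans (sym (perfect (corner (suc i) hi) (ℕₚ.<⇒≤ p)))
        (cong (λ r → bit (m (border (suc i))) ℕ.+ (bit (m (link (suc i) hi spokeL)) ℕ.+ (bit r ℕ.+ 0)))
          (sym (spokesR-agree i (ℕₚ.<⇒≤ p))))))))

    spokesR-agree i p = trans (hexagon i lo p spokeR) (trans
      (spokeR-agree (m (centre i)) _ _
        (trans (sym (hexagon i lo p spokeL)) (trans (spokesL-agree i p) (hexagon i hi p spokeL))))
      (sym (hexagon i hi p spokeR)))

    letter : ℕ → Letter
    letter i = if m (centre i) then bridge (m (link i lo outerL)) else hex (m (link i lo outerL)) (m (link i hi outerL))

    letter-centre : ∀ i → bridged (letter i) ≡ m (centre i)
    letter-centre i with m (centre i)
    ... | true  = refl
    ... | false = refl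

    letter-orientation : ∀ i → i ℕ.< n → ∀ σ → orientation (letter i) σ ≡ m (link i σ outerL)
    letter-orientation i p σ
      with m (centre i) | hexagon i lo p spokeL | hexagon i hi p spokeL
    letter-orientation i p lo | true  | _ | _ = refl
    letter-orientation i p hi | true  | l | h = trans (sym l) (trans (spokesL-agree i p) h)
    letter-orientation i p lo | false | _ | _ = refl
    letter-orientation i p hi | false | _ | _ = refl

  wordOf : Word n
  wordOf = build letter n

  uses-wordOf-link : ∀ i σ l → m (link i σ l) ≡ uses wordOf (link i σ l)
  uses-wordOf-link i σ l with i ℕ.<? n
  ... | no i≮n rewrite at-outside wordOf i≮n = absent (link i σ l) i≮n
  ... | yes p  rewrite at-build letter p | letter-centre i | letter-orientation i p σ = hexagon i σ p l

  private
    borders : ∀ i → i ℕ.< n → m (border (suc i)) ≡ not (rightward (at wordOf i)) ∧ not (leftward (at wordOf (suc i)))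
                             × rightward (at wordOf i) ∧ leftward (at wordOf (suc i)) ≡ false
    borders i p rewrite sym (uses-wordOf-link i lo spokeR) | sym (uses-wordOf-link (suc i) lo spokeL) =
      border-forced (m (link (suc i) lo spokeL)) (m (link i lo spokeR)) (perfect (corner (suc i) lo) p)

  wordOf-admissible : Admissible false wordOf
  wordOf-admissible = at⇒admissible wordOf refl λ i → go i (i ℕ.<? n)
    where
    go : ∀ i → Dec (i ℕ.< n) → rightward (at wordOf i) ∧ leftward (at wordOf (suc i)) ≡ false
    go i (yes p)  = proj₂ (borders i p)
    go i (no i≮n) rewrite at-outside wordOf i≮n = refl

  uses-wordOf : ∀ e → m e ≡ uses wordOf e
  uses-wordOf (link i σ l) = uses-wordOf-link i σ l
  uses-wordOf (centre i) with i ℕ.<? n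
  ... | no i≮n rewrite at-outside wordOf i≮n = absent (centre i) i≮n
  ... | yes p  rewrite at-build letter p = sym (letter-centre i)
  uses-wordOf (border zero) with 0 ℕ.<? n
  ... | no 0≮n rewrite at-outside wordOf 0≮n = absent (border 0) 0≮n
  ... | yes p = trans (trans (sym (Boolₚ.not-involutive _)) (cong not (sym (complement {m (border 0)} (perfect (corner 0 lo) p)))))
                      (trans (cong not (uses-wordOf-link 0 lo spokeL)) (first-border p))
    where
    first-border : 0 ℕ.< n → not (leftward (at wordOf 0)) ≡ usesBorder nothing (at wordOf 0)
    first-border p rewrite at-build letter p = refl
  uses-wordOf (border (suc i)) with i ℕ.<? n
  ... | no i≮n rewrite at-outside wordOf i≮n | at-outside wordOf (i≮n ∘ ℕₚ.<⇒≤) = absent (border (suc i)) i≮n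
  ... | yes p = trans (proj₁ (borders i p)) (occupied p)
    where
    occupied : i ℕ.< n → not (rightward (at wordOf i)) ∧ not (leftward (at wordOf (suc i)))
                       ≡ usesBorder (at wordOf i) (at wordOf (suc i))
    occupied p rewrite at-build letter p = refl

Slot : Set
Slot = ℕ × Side

shift : Slot → Slot
shift (i , σ) = suc i , σ

shift-injective : ∀ {t u} → shift t ≡ shift u → t ≡ u
shift-injective refl = refl

headSlots : Letter → List Slot
headSlots (hex _ _)  = (0 , lo) ∷ (0 , hi) ∷ []
headSlots (bridge _) = (0 , lo) ∷ []

slots : ∀ {n} → Word n → List Slot
slots []      = []
slots (s ∷ w) = headSlots s ++ map shift (slots w)

cost : Letter → ℕ
cost (hex _ _)  = 2
cost (bridge _) = 1

weight : ∀ {n} → Word n → ℕ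
weight []      = 0
weight (s ∷ w) = cost s ℕ.+ weight w

length-slots : ∀ {n} (w : Word n) → length (slots w) ≡ weight w
length-slots []               = refl
length-slots (hex _ _ ∷ w)  = cong (2 ℕ.+_) (trans (length-map shift (slots w)) (length-slots w))
length-slots (bridge _ ∷ w) = cong suc (trans (length-map shift (slots w)) (length-slots w))

slots-unique : ∀ {n} (w : Word n) → Unique (slots w)
slots-unique []      = []
slots-unique (s ∷ w) = Uniqueₚ.++⁺ (unique s) (Uniqueₚ.map⁺ shift-injective (slots-unique w)) disjoint
  where
  unique : ∀ s → Unique (headSlots s)
  unique (hex _ _)  = ((λ ()) ∷ []) ∷ [] ∷ []
  unique (bridge _) = [] ∷ []
  index : ∀ s {t} → t ∈ headSlots s → proj₁ t ≡ 0
  index (hex _ _)  #0 = refl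
  index (hex _ _)  #1 = refl
  index (bridge _) #0 = refl
  disjoint : ∀ {t} → ¬ (t ∈ headSlots s × t ∈ map shift (slots w))
  disjoint (p , q) with ∈-map⁻ shift q
  ... | _ , _ , refl with () ← index s p

-- Both edges to the border, like the centre, are charged to the single slot of a
-- bridge.  The value on border edges is arbitrary: a flip never
-- loses them.
slotOf : Edge → Slot
slotOf (link i σ spokeL) = i , lo
slotOf (link i σ spokeR) = i , lo
slotOf (link i σ l)      = i , σ
slotOf (centre i)        = i , lo
slotOf (border i)        = i , lo

data Flip : ∀ {n} → Word n → Slot → Word n → Set where
  flip-lo     : ∀ {n a b} {w : Word n} → Flip (hex a b ∷ w) (0 , lo) (hex (not a) b ∷ w)
  flip-hi     : ∀ {n a b} {w : Word n} → Flip (hex a b ∷ w) (0 , hi) (hex a (not b) ∷ w)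
  flip-bridge : ∀ {n o} {w : Word n} → Flip (bridge o ∷ w) (0 , lo) (hex o o ∷ w)
  later       : ∀ {n s t} {w w′ : Word n} → Flip w t w′ → Flip (s ∷ w) (shift t) (s ∷ w′)

flip-exists : ∀ {n} (w : Word n) {t} → t ∈ slots w → ∃[ w′ ] Flip w t w′
flip-exists (s ∷ w) t∈ with ∈-++⁻ (headSlots s) t∈
flip-exists (hex a b ∷ w)  t∈ | inj₁ #0 = _ , flip-lo
flip-exists (hex a b ∷ w)  t∈ | inj₁ #1 = _ , flip-hi
flip-exists (bridge o ∷ w) t∈ | inj₁ #0 = _ , flip-bridge
... | inj₂ q with u , u∈ , refl ← ∈-map⁻ shift q with w′ , f ← flip-exists w u∈ = s ∷ w′ , later f

flip-changes : ∀ {n t} {w w′ : Word n} → Flip w t w′ → w′ ≢ w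
flip-changes (flip-lo {a = a}) eq = Boolₚ.not-¬ refl (sym (cong (λ w → orientation (Vec.head w) lo) eq))
flip-changes (flip-hi {b = b}) eq = Boolₚ.not-¬ refl (sym (cong (λ w → orientation (Vec.head w) hi) eq))
flip-changes flip-bridge ()
flip-changes (later f) eq = flip-changes f (cong Vec.tail eq)

admissible-relax : ∀ {n r} (w : Word n) → Admissible r w → Admissible false w
admissible-relax []      _       = tt
admissible-relax (s ∷ w) (_ , a) = refl , a

flip-admissible : ∀ {n r t} {w w′ : Word n} → Flip w t w′ → Admissible r w → Admissible r w′
flip-admissible flip-lo (p , a) = p , a
flip-admissible flip-hi (p , a) = p , a
flip-admissible {r = r} (flip-bridge {w = w}) (_ , a) = Boolₚ.∧-zeroʳ r , admissible-relax w a
flip-admissible (later f) (p , a) = p , flip-admissible f a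

flip-at : ∀ {n t} {w w′ : Word n} → Flip w t w′ → ∀ i →
          at w′ i ≡ at w i ⊎ ∃[ s ] ∃[ a ] ∃[ b ] (at w i ≡ just s × at w′ i ≡ just (hex a b))
flip-at flip-lo     zero    = inj₂ (_ , _ , _ , refl , refl)
flip-at flip-lo     (suc i) = inj₁ refl
flip-at flip-hi     zero    = inj₂ (_ , _ , _ , refl , refl)
flip-at flip-hi     (suc i) = inj₁ refl
flip-at flip-bridge zero    = inj₂ (_ , _ , _ , refl , refl)
flip-at flip-bridge (suc i) = inj₁ refl
flip-at (later f)   zero    = inj₁ refl
flip-at (later f)   (suc i) = flip-at f i

border-relaxˡ : ∀ s t a b → usesBorder (just s) t ≡ true → usesBorder (just (hex a b)) t ≡ true
border-relaxˡ s t a b p with rightward (just s)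
... | false = p

border-relaxʳ : ∀ s t a b → usesBorder s (just t) ≡ true → usesBorder s (just (hex a b)) ≡ true
border-relaxʳ s t a b p with is-just s | rightward s | leftward (just t)
... | true  | false | false = refl
... | false | false | false = refl

flip-border : ∀ {n t} {w w′ : Word n} → Flip w t w′ → ∀ i → uses w (border i) ≡ true → uses w′ (border i) ≡ true
flip-border {w = w} {w′} f zero p with at w 0 | at w′ 0 | flip-at f 0
... | _ | _ | inj₁ refl                        = p
... | _ | _ | inj₂ (s , a , b , refl , refl)   = border-relaxʳ nothing s a b p
flip-border {w = w} {w′} f (suc i) p
  with at w i | at w′ i | flip-at f i | at w (suc i) | at w′ (suc i) | flip-at f (suc i)
... | _ | _ | inj₁ refl                      | _ | _ | inj₁ refl                      = p
... | s | _ | inj₁ refl                      | _ | _ | inj₂ (t , c , d , refl , refl) = border-relaxʳ s t c d p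
... | _ | _ | inj₂ (s , a , b , refl , refl) | t | _ | inj₁ refl                      = border-relaxˡ s t a b p
... | _ | _ | inj₂ (s , a , b , refl , refl) | _ | _ | inj₂ (t , c , d , refl , refl) =
  border-relaxˡ s (just (hex c d)) a b (border-relaxʳ (just s) t c d p)

flip-lost : ∀ {n t} {w w′ : Word n} → Flip w t w′ → ∀ e → uses w e ≡ true → uses w′ e ≡ false → slotOf e ≡ t
flip-lost f (border i) p q with () ← trans (sym (flip-border f i p)) q
flip-lost flip-lo (link zero lo outerL) p q = refl
flip-lost flip-lo (link zero lo outerR) p q = refl
flip-lost flip-lo (link zero lo sideL) p q = refl
flip-lost flip-lo (link zero lo sideR) p q = refl
flip-lost flip-lo (link zero lo innerL) p q = refl
flip-lost flip-lo (link zero lo innerR) p q = refl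
flip-lost flip-lo (link zero hi l) p q with () ← trans (sym p) q
flip-lost flip-lo (link (suc i) σ l) p q with () ← trans (sym p) q
flip-lost flip-lo (centre (suc i)) p q with () ← trans (sym p) q
flip-lost flip-hi (link zero hi outerL) p q = refl
flip-lost flip-hi (link zero hi outerR) p q = refl
flip-lost flip-hi (link zero hi sideL) p q = refl
flip-lost flip-hi (link zero hi sideR) p q = refl
flip-lost flip-hi (link zero hi innerL) p q = refl
flip-lost flip-hi (link zero hi innerR) p q = refl
flip-lost flip-hi (link zero lo l) p q with () ← trans (sym p) q
flip-lost flip-hi (link (suc i) σ l) p q with () ← trans (sym p) q
flip-lost flip-hi (centre (suc i)) p q with () ← trans (sym p) q
flip-lost flip-bridge (link zero lo outerL) p q with () ← trans (sym p) q
flip-lost flip-bridge (link zero lo outerR) p q with () ← trans (sym p) q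
flip-lost flip-bridge (link zero lo sideL) p q with () ← trans (sym p) q
flip-lost flip-bridge (link zero lo sideR) p q with () ← trans (sym p) q
flip-lost flip-bridge (link zero hi outerL) p q with () ← trans (sym p) q
flip-lost flip-bridge (link zero hi outerR) p q with () ← trans (sym p) q
flip-lost flip-bridge (link zero hi sideL) p q with () ← trans (sym p) q
flip-lost flip-bridge (link zero hi sideR) p q with () ← trans (sym p) q
flip-lost flip-bridge (link zero σ spokeL) p q = refl
flip-lost flip-bridge (link zero σ spokeR) p q = refl
flip-lost flip-bridge (link (suc i) σ l) p q with () ← trans (sym p) q
flip-lost flip-bridge (centre zero) p q = refl
flip-lost flip-bridge (centre (suc i)) p q with () ← trans (sym p) q
flip-lost (later f) (link zero σ l) p q with () ← trans (sym p) q
flip-lost (later f) (link (suc i) σ l) p q = trans (slotOf-suc l) (cong shift (flip-lost f (link i σ l) p q))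
  where
  slotOf-suc : ∀ l → slotOf (link (suc i) σ l) ≡ shift (slotOf (link i σ l))
  slotOf-suc outerL = refl
  slotOf-suc outerR = refl
  slotOf-suc sideL  = refl
  slotOf-suc sideR  = refl
  slotOf-suc innerL = refl
  slotOf-suc innerR = refl
  slotOf-suc spokeL = refl
  slotOf-suc spokeR = refl
flip-lost (later f) (centre zero) p q with () ← trans (sym p) q
flip-lost (later f) (centre (suc i)) p q = cong shift (flip-lost f (centre i) p q)

key : Letter → Side → Link
key s σ = if bridged s then (if orientation s σ then spokeL else spokeR)
                       else (if orientation s σ then innerL else innerR)

pick : ∀ {n} → Word n → Slot → Edge
pick w (i , σ) = link i σ (maybe (λ s → key s σ) outerL (at w i))

uses-key : ∀ s σ → usesLink (just s) σ (key s σ) ≡ true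
uses-key s σ with bridged s | orientation s σ
... | true  | true  = refl
... | true  | false = refl
... | false | true  = refl
... | false | false = refl

uses-pick : ∀ {n} (w : Word n) {t} → t ∈ slots w → uses w (pick w t) ≡ true
uses-pick (s ∷ w) t∈ with ∈-++⁻ (headSlots s) t∈
uses-pick (s@(hex _ _) ∷ w)  t∈ | inj₁ #0 = uses-key s lo
uses-pick (s@(hex _ _) ∷ w)  t∈ | inj₁ #1 = uses-key s hi
uses-pick (s@(bridge _) ∷ w) t∈ | inj₁ #0 = uses-key s lo
... | inj₂ q with u , u∈ , refl ← ∈-map⁻ shift q = uses-pick w u∈

hex-key : ∀ a a′ → hexagonLink false a′ (if a then innerL else innerR) ≡ true → a ≡ a′
hex-key true  true  _ = refl
hex-key false false _ = refl

¬bridge-key : ∀ a a′ → hexagonLink true a′ (if a then innerL else innerR) ≢ true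
¬bridge-key true  _ ()
¬bridge-key false _ ()

key-determines : ∀ s s′ → (∀ {σ} → (0 , σ) ∈ headSlots s → usesLink (just s′) σ (key s σ) ≡ true) → s ≡ s′
key-determines (hex a b) (hex a′ b′) h = cong₂ hex (hex-key a a′ (h #0)) (hex-key b b′ (h #1))
key-determines (hex a b) (bridge o) h = ⊥-elim (¬bridge-key a o (h #0))
key-determines (bridge true)  (bridge true)  h = refl
key-determines (bridge false) (bridge false) h = refl
key-determines (bridge true)  (bridge false) h with () ← h #0
key-determines (bridge false) (bridge true)  h with () ← h #0
key-determines (bridge true)  (hex _ _) h with () ← h #0
key-determines (bridge false) (hex _ _) h with () ← h #0

picks-determine : ∀ {n} (w w′ : Word n) → (∀ {t} → t ∈ slots w → uses w′ (pick w t) ≡ true) → w ≡ w′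
picks-determine [] [] _ = refl
picks-determine (s ∷ w) (s′ ∷ w′) h = cong₂ _∷_
  (key-determines s s′ (λ t∈ → h (∈-++⁺ˡ t∈)))
  (picks-determine w w′ (λ {t} t∈ → h {shift t} (∈-++⁺ʳ (headSlots s) (∈-map⁺ shift t∈))))

letters : Bool → List Letter
letters r = bridge false ∷ hex true true ∷ hex true false ∷ hex false true ∷ hex false false
          ∷ (if r then [] else bridge true ∷ [])

words : Bool → ∀ n → List (Word n)
words r zero    = [] ∷ []
words r (suc n) = concatMap (λ s → map (s ∷_) (words (rightward (just s)) n)) (letters r)

letters-unique : ∀ r → Unique (letters r)
letters-unique true =
    ((λ ()) ∷ (λ ()) ∷ (λ ()) ∷ (λ ()) ∷ []) ∷ ((λ ()) ∷ (λ ()) ∷ (λ ()) ∷ [])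
  ∷ ((λ ()) ∷ (λ ()) ∷ []) ∷ ((λ ()) ∷ []) ∷ [] ∷ []
letters-unique false =
    ((λ ()) ∷ (λ ()) ∷ (λ ()) ∷ (λ ()) ∷ (λ ()) ∷ []) ∷ ((λ ()) ∷ (λ ()) ∷ (λ ()) ∷ (λ ()) ∷ [])
  ∷ ((λ ()) ∷ (λ ()) ∷ (λ ()) ∷ []) ∷ ((λ ()) ∷ (λ ()) ∷ []) ∷ ((λ ()) ∷ []) ∷ [] ∷ []

∈-letters⁺ : ∀ r s → r ∧ leftward (just s) ≡ false → s ∈ letters r
∈-letters⁺ r (bridge false)    _ = #0
∈-letters⁺ r (hex true true)   _ = #1
∈-letters⁺ r (hex true false)  _ = #2
∈-letters⁺ r (hex false true)  _ = #3
∈-letters⁺ r (hex false false) _ = there #3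
∈-letters⁺ false (bridge true) _ = there (there #3)

∈-letters⁻ : ∀ r {s} → s ∈ letters r → r ∧ leftward (just s) ≡ false
∈-letters⁻ true  s∈ = All.lookup {P = λ s → leftward (just s) ≡ false} (refl ∷ refl ∷ refl ∷ refl ∷ refl ∷ []) s∈
∈-letters⁻ false s∈ = refl

words-unique : ∀ r n → Unique (words r n)
words-unique r zero    = [] ∷ []
words-unique r (suc n) = Uniqueₚ.concat⁺
  (Allₚ.map⁺ (All.universal (λ s → Uniqueₚ.map⁺ Vecₚ.∷-injectiveʳ (words-unique _ n)) (letters r)))
  (AllPairsₚ.map⁺ (AllPairs.map disjoint (letters-unique r)))
  where
  disjoint : ∀ {s t} → s ≢ t → ∀ {w} →
             ¬ (w ∈ map (s ∷_) (words (rightward (just s)) n) × w ∈ map (t ∷_) (words (rightward (just t)) n))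
  disjoint s≢t (p , q) with _ , _ , refl ← ∈-map⁻ _ p with _ , _ , eq ← ∈-map⁻ _ q = s≢t (Vecₚ.∷-injectiveˡ eq)

∈-words⁺ : ∀ {n} r (w : Word n) → Admissible r w → w ∈ words r n
∈-words⁺ r []      _       = #0
∈-words⁺ r (s ∷ w) (p , a) = ∈-concatMap⁺ (λ s → map (s ∷_) (words (rightward (just s)) _))
  (lose (∈-letters⁺ r s p) (∈-map⁺ (s ∷_) (∈-words⁺ _ w a)))

∈-words⁻ : ∀ {n} r {w : Word n} → w ∈ words r n → Admissible r w
∈-words⁻ {zero} r #0 = tt
∈-words⁻ {suc n} r w∈
  with s , s∈ , w∈s ← find (∈-concatMap⁻ (λ s → map (s ∷_) (words (rightward (just s)) n)) {xs = letters r} w∈)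
  with w′ , w′∈ , refl ← ∈-map⁻ (s ∷_) w∈s = ∈-letters⁻ r s∈ , ∈-words⁻ (rightward (just s)) w′∈

forcingNumber-≡ : ∀ (G : Graph) M k →
  (∃[ S ] S ∈ subsets M × IsForcing G M S × length S ℕ.≤ k) →
  (∀ S → S ∈ subsets M → IsForcing G M S → k ℕ.≤ length S) →
  forcingNumber G M ≡ k
forcingNumber-≡ G M k (S , S∈ , S-forces , S≤k) bound = ℕₚ.≤-antisym
  (min≤v⁺ (length M) _ (inj₂ (lose (∈-map⁺ length (∈-filter⁺ (isForcing? G M) S∈ S-forces)) S≤k)))
  (v≤min⁺ k≤M (Allₚ.map⁺ (All.tabulate λ T∈ →
    let T∈′ , T-forces = ∈-filter⁻ (isForcing? G M) {xs = subsets M} T∈ in bound _ T∈′ T-forces)))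
  where
  k≤M : k ℕ.≤ length M
  k≤M = ℕₚ.≤-trans (bound S S∈ S-forces) (length≤ M S∈)
    where
    length≤ : ∀ {A : Set} {T} (xs : List A) → T ∈ subsets xs → length T ℕ.≤ length xs
    length≤ [] (here refl) = ℕ.z≤n
    length≤ (x ∷ xs) p with ∈-++⁻ (map (x ∷_) (subsets xs)) p
    ... | inj₂ q = ℕₚ.m≤n⇒m≤1+n (length≤ xs q)
    ... | inj₁ q with _ , T∈ , refl ← ∈-map⁻ (x ∷_) q = ℕ.s≤s (length≤ xs T∈)

module _ {n : ℕ} (G : Graph) (presents : Presents n G) where
  open Graph G using (edges; edges-unique; _≟ᴱ_)
  open Presents presents
  open DecMembership _≟ᴱ_ using (_∈?_)

  private
    used? : ∀ (w : Word n) s → Dec (uses w (name s) ≡ true)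
    used? w s = uses w (name s) Boolₚ.≟ true

  matching : Word n → List (Graph.Edge G)
  matching w = filter (used? w) edges

  matching-subset : ∀ w → matching w ∈ subsets edges
  matching-subset w = filter-∈-subsets (used? w) edges

  ∈-matching⁺ : ∀ w e → uses w e ≡ true → span e ∈ matching w
  ∈-matching⁺ w e p = ∈-filter⁺ (used? w) (edges⁺ e (uses⇒inside w e p))
    (trans (cong (uses w) (name-span e)) p)

  ∈-matching⁻ : ∀ w {s} → s ∈ matching w → ∃[ e ] s ≡ span e × uses w e ≡ true
  ∈-matching⁻ w s∈ with s∈E , p ← ∈-filter⁻ (used? w) {xs = edges} s∈
    with e , _ , refl ← edges⁻ s∈E = e , refl , trans (cong (uses w) (sym (name-span e))) p

  span∈matching⇒uses : ∀ w e → span e ∈ matching w → uses w e ≡ true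
  span∈matching⇒uses w e s∈ with f , eq , p ← ∈-matching⁻ w s∈
    with refl ← span-injective G presents {e} {f} eq = p

  member-matching : ∀ w e → member G presents (matching w) e ≡ uses w e
  member-matching w e with span e ∈? matching w
  ... | yes p = sym (span∈matching⇒uses w e p)
  ... | no ¬p = sym (Boolₚ.¬-not (¬p ∘ ∈-matching⁺ w e))

  matching-perfect : ∀ w → Admissible false w → matching w ∈ perfectMatchings G
  matching-perfect w a = ∈-filter⁺ (isPerfect? G) (matching-subset w)
    (count⇒perfect G presents (matching-subset w)
      (λ v p → trans (count-cong (member-matching w) (star v)) (uses-perfect w a v p)))
    where
    count-cong : ∀ {p q} → p ≗ q → ∀ es → count p es ≡ count q es
    count-cong eq []       = refl
    count-cong eq (e ∷ es) = cong₂ (λ b k → bit b ℕ.+ k) (eq e) (count-cong eq es)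

  perfect-matching : ∀ {M} → M ∈ perfectMatchings G → ∃[ w ] Admissible false w × M ≡ matching w
  perfect-matching {M} M∈pm with M∈ , pm ← ∈-filter⁻ (isPerfect? G) {xs = subsets edges} M∈pm =
    w , wordOf-admissible m inside perfect ,
    subset≡filter (used? w) edges-unique M∈ to from
    where
    m = member G presents M
    inside = member⇒inside G presents M∈
    perfect = perfect⇒count G presents M∈ pm
    w = wordOf m inside perfect
    to : ∀ {s} → s ∈ edges → s ∈ M → uses w (name s) ≡ true
    to s∈E s∈M with e , _ , refl ← edges⁻ s∈E rewrite name-span e =
      trans (sym (uses-wordOf m inside perfect e)) (does-true (span e ∈? M) s∈M)
    from : ∀ {s} → s ∈ edges → uses w (name s) ≡ true → s ∈ M
    from s∈E p with e , _ , refl ← edges⁻ s∈E rewrite name-span e =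
      true-does (span e ∈? M) (trans (uses-wordOf m inside perfect e) p)

  matching-injective : ∀ {w w′} → matching w ≡ matching w′ → w ≡ w′
  matching-injective {w} {w′} eq = picks-determine w w′ λ {t} t∈ →
    span∈matching⇒uses w′ (pick w t) (subst (span (pick w t) ∈_) eq (∈-matching⁺ w (pick w t) (uses-pick w t∈)))

  private
    picks : Word n → List (Graph.Edge G)
    picks w = filter (_∈? map (span ∘ pick w) (slots w)) (matching w)

  picks-forcing : ∀ w → IsForcing G (matching w) (picks w)
  picks-forcing w = All.tabulate λ M∈ S⊆M → forced (perfect-matching M∈) S⊆M
    where
    forced : ∀ {M} → ∃[ w′ ] Admissible false w′ × M ≡ matching w′ → picks w ⊆ M → M ≡ matching w
    forced (w′ , _ , refl) S⊆M = cong matching (sym (picks-determine w w′ λ {t} t∈ →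
      span∈matching⇒uses w′ (pick w t) (S⊆M (∈-filter⁺ (_∈? map (span ∘ pick w) (slots w))
        (∈-matching⁺ w (pick w t) (uses-pick w t∈)) (∈-map⁺ (span ∘ pick w) t∈)))))

  length-picks : ∀ w → length (picks w) ℕ.≤ weight w
  length-picks w = begin
    length (picks w)                             ≤⟨ unique-⊆⇒length≤
      (Uniqueₚ.filter⁺ (_∈? map (span ∘ pick w) (slots w)) (Uniqueₚ.filter⁺ (used? w) edges-unique))
      (proj₂ ∘ ∈-filter⁻ (_∈? map (span ∘ pick w) (slots w)) {xs = matching w}) ⟩
    length (map (span ∘ pick w) (slots w))       ≡⟨ length-map (span ∘ pick w) (slots w) ⟩
    length (slots w)                             ≡⟨ length-slots w ⟩
    weight w                                     ∎
    where open ℕₚ.≤-Reasoning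

  forcing-bound : ∀ w → Admissible false w → ∀ S → S ∈ subsets (matching w) →
                  IsForcing G (matching w) S → weight w ℕ.≤ length S
  forcing-bound w a S S∈ forces = begin
    weight w                         ≡⟨ length-slots w ⟨
    length (slots w)                 ≤⟨ unique-⊆⇒length≤ (slots-unique w) hit ⟩
    length (map (slotOf ∘ name) S)   ≡⟨ length-map (slotOf ∘ name) S ⟩
    length S                         ∎
    where
    open ℕₚ.≤-Reasoning
    hit : slots w ⊆ map (slotOf ∘ name) S
    hit {t} t∈ with w′ , f ← flip-exists w t∈ with All.all? (_∈? matching w′) S
    ... | yes S⊆ = ⊥-elim (flip-changes f (matching-injective
      (All.lookup forces (matching-perfect w′ (flip-admissible f a)) (All.lookup S⊆))))
    ... | no S⊈ with s , s∈S , s∉ ← find (Allₚ.¬All⇒Any¬ (_∈? matching w′) S S⊈)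
      with e , refl , p ← ∈-matching⁻ w (∈-subsets⇒⊆ (matching w) S∈ s∈S) =
      subst (_∈ map (slotOf ∘ name) S)
        (trans (cong slotOf (name-span e)) (flip-lost f e p (Boolₚ.¬-not (s∉ ∘ ∈-matching⁺ w′ e))))
        (∈-map⁺ (slotOf ∘ name) s∈S)

  forcingNumber-matching : ∀ w → Admissible false w → forcingNumber G (matching w) ≡ weight w
  forcingNumber-matching w a = forcingNumber-≡ G (matching w) (weight w)
    (picks w , filter-∈-subsets (_∈? map (span ∘ pick w) (slots w)) (matching w) , picks-forcing w , length-picks w)
    (forcing-bound w a)

  IDF≡sum-weights : IDF G ≡ sum (map weight (words false n))
  IDF≡sum-weights = begin
    sum (map (forcingNumber G) (perfectMatchings G))
      ≡⟨ sum-↭ (map⁺ (forcingNumber G) (unique-sameElements⇒↭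
           (Uniqueₚ.filter⁺ (isPerfect? G) (subsets-unique edges-unique))
           (Uniqueₚ.map⁺ matching-injective (words-unique false n)) to from)) ⟩
    sum (map (forcingNumber G) (map matching (words false n)))
      ≡⟨ cong sum (map-∘ (words false n)) ⟨
    sum (map (forcingNumber G ∘ matching) (words false n))
      ≡⟨ cong sum (map-cong-local (All.tabulate λ w∈ → forcingNumber-matching _ (∈-words⁻ false w∈))) ⟩
    sum (map weight (words false n)) ∎
    where
    open ≡-Reasoning
    to : perfectMatchings G ⊆ map matching (words false n)
    to M∈ with w , a , refl ← perfect-matching M∈ = ∈-map⁺ matching (∈-words⁺ false w a)
    from : map matching (words false n) ⊆ perfectMatchings G
    from M∈ with w , w∈ , refl ← ∈-map⁻ matching M∈ = matching-perfect w (∈-words⁻ false w∈)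

IDF-H : ∀ n → IDF (H n) ≡ sum (map weight (words false n))
IDF-H n = IDF≡sum-weights (H n) (H-presented n)

-- (3 + 2√2)^n = pellX n + 2 (pellY n) √2.
pellX pellY : ℕ → ℕ
pellX zero    = 1
pellX (suc n) = 3 ℕ.* pellX n ℕ.+ 8 ℕ.* pellY n
pellY zero    = 0
pellY (suc n) = pellX n ℕ.+ 3 ℕ.* pellY n

module _ {n} (W : Letter → List (Word n)) where

  length-concatMap-∷ : ∀ ss → length (concatMap (λ s → map (s ∷_) (W s)) ss) ≡ sum (map (length ∘ W) ss)
  length-concatMap-∷ []       = refl
  length-concatMap-∷ (s ∷ ss) = trans (length-++ (map (s ∷_) (W s)))
    (cong₂ ℕ._+_ (length-map (s ∷_) (W s)) (length-concatMap-∷ ss))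

  sum-weight-∷ : ∀ s ws → sum (map weight (map (s ∷_) ws)) ≡ cost s ℕ.* length ws ℕ.+ sum (map (weight {n}) ws)
  sum-weight-∷ s []       = sym (trans (ℕₚ.+-identityʳ _) (ℕₚ.*-zeroʳ (cost s)))
  sum-weight-∷ s (w ∷ ws) = trans (cong (cost s ℕ.+ weight w ℕ.+_) (sum-weight-∷ s ws))
    (regroup (cost s) (weight w) (length ws) _)
    where
    regroup : ∀ c k l t → c ℕ.+ k ℕ.+ (c ℕ.* l ℕ.+ t) ≡ c ℕ.* suc l ℕ.+ (k ℕ.+ t)
    regroup = solve-∀

  sum-weight-concatMap-∷ : ∀ ss → sum (map weight (concatMap (λ s → map (s ∷_) (W s)) ss))
                               ≡ sum (map (λ s → cost s ℕ.* length (W s) ℕ.+ sum (map weight (W s))) ss)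
  sum-weight-concatMap-∷ []       = refl
  sum-weight-concatMap-∷ (s ∷ ss) = trans (cong sum (map-++ weight (map (s ∷_) (W s)) _))
    (trans (sum-++ (map weight (map (s ∷_) (W s))) _)
      (cong₂ ℕ._+_ (sum-weight-∷ s (W s)) (sum-weight-concatMap-∷ ss)))

size total : Bool → ℕ → ℕ
size  r n = length (words r n)
total r n = sum (map weight (words r n))

size-suc : ∀ n → size false (suc n) ≡ size true n ℕ.+ 5 ℕ.* size false n
               × size true (suc n) ≡ size true n ℕ.+ 4 ℕ.* size false n
size-suc n = length-concatMap-∷ (λ s → words (rightward (just s)) n) (letters false)
           , length-concatMap-∷ (λ s → words (rightward (just s)) n) (letters true)

size-closed : ∀ n → size false n ≡ pellX n ℕ.+ 3 ℕ.* pellY n × size true n ≡ pellX n ℕ.+ 2 ℕ.* pellY n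
size-closed zero    = refl , refl
size-closed (suc n) with ihf , iht ← size-closed n with sf , st ← size-suc n
  rewrite sf | st | ihf | iht = ringf (pellX n) (pellY n) , ringt (pellX n) (pellY n)
  where
  ringf : ∀ x y → x ℕ.+ 2 ℕ.* y ℕ.+ 5 ℕ.* (x ℕ.+ 3 ℕ.* y) ≡ 3 ℕ.* x ℕ.+ 8 ℕ.* y ℕ.+ 3 ℕ.* (x ℕ.+ 3 ℕ.* y)
  ringf = solve-∀
  ringt : ∀ x y → x ℕ.+ 2 ℕ.* y ℕ.+ 4 ℕ.* (x ℕ.+ 3 ℕ.* y) ≡ 3 ℕ.* x ℕ.+ 8 ℕ.* y ℕ.+ 2 ℕ.* (x ℕ.+ 3 ℕ.* y)
  ringt = solve-∀

total-suc : ∀ n → total false (suc n) ≡ size true n ℕ.+ 9 ℕ.* size false n ℕ.+ total true n ℕ.+ 5 ℕ.* total false n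
                × total true (suc n) ≡ size true n ℕ.+ 8 ℕ.* size false n ℕ.+ total true n ℕ.+ 4 ℕ.* total false n
total-suc n =
    trans (sum-weight-concatMap-∷ (λ s → words (rightward (just s)) n) (letters false))
      (ringf (size false n) (size true n) (total false n) (total true n))
  , trans (sum-weight-concatMap-∷ (λ s → words (rightward (just s)) n) (letters true))
      (ringt (size false n) (size true n) (total false n) (total true n))
  where
  ringf : ∀ a b s t → let h = 2 ℕ.* a ℕ.+ s in
    1 ℕ.* b ℕ.+ t ℕ.+ (h ℕ.+ (h ℕ.+ (h ℕ.+ (h ℕ.+ (1 ℕ.* a ℕ.+ s ℕ.+ 0))))) ≡ b ℕ.+ 9 ℕ.* a ℕ.+ t ℕ.+ 5 ℕ.* s
  ringf = solve-∀
  ringt : ∀ a b s t → let h = 2 ℕ.* a ℕ.+ s in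
    1 ℕ.* b ℕ.+ t ℕ.+ (h ℕ.+ (h ℕ.+ (h ℕ.+ (h ℕ.+ 0)))) ≡ b ℕ.+ 8 ℕ.* a ℕ.+ t ℕ.+ 4 ℕ.* s
  ringt = solve-∀

total-false-step : ∀ n x y s t {a b u} → a ≡ x ℕ.+ 3 ℕ.* y → b ≡ x ℕ.+ 2 ℕ.* y →
  u ≡ b ℕ.+ 9 ℕ.* a ℕ.+ t ℕ.+ 5 ℕ.* s →
  4 ℕ.* s ℕ.+ y ≡ n ℕ.* (7 ℕ.* x ℕ.+ 20 ℕ.* y) → 2 ℕ.* t ≡ n ℕ.* (3 ℕ.* x ℕ.+ 8 ℕ.* y) ℕ.+ y →
  4 ℕ.* u ℕ.+ (x ℕ.+ 3 ℕ.* y) ≡ suc n ℕ.* (7 ℕ.* (3 ℕ.* x ℕ.+ 8 ℕ.* y) ℕ.+ 20 ℕ.* (x ℕ.+ 3 ℕ.* y))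
total-false-step n x y s t refl refl refl hs ht = ℕₚ.+-cancelʳ-≡ (5 ℕ.* y) _ _
  (trans (expand x y s t) (trans (cong₂ (λ v w → 41 ℕ.* x ℕ.+ 119 ℕ.* y ℕ.+ 2 ℕ.* v ℕ.+ 5 ℕ.* w) ht hs) (collect n x y)))
  where
  expand : ∀ x y s t →
    4 ℕ.* (x ℕ.+ 2 ℕ.* y ℕ.+ 9 ℕ.* (x ℕ.+ 3 ℕ.* y) ℕ.+ t ℕ.+ 5 ℕ.* s) ℕ.+ (x ℕ.+ 3 ℕ.* y) ℕ.+ 5 ℕ.* y
    ≡ 41 ℕ.* x ℕ.+ 119 ℕ.* y ℕ.+ 2 ℕ.* (2 ℕ.* t) ℕ.+ 5 ℕ.* (4 ℕ.* s ℕ.+ y)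
  expand = solve-∀
  collect : ∀ n x y →
    41 ℕ.* x ℕ.+ 119 ℕ.* y ℕ.+ 2 ℕ.* (n ℕ.* (3 ℕ.* x ℕ.+ 8 ℕ.* y) ℕ.+ y) ℕ.+ 5 ℕ.* (n ℕ.* (7 ℕ.* x ℕ.+ 20 ℕ.* y))
    ≡ suc n ℕ.* (7 ℕ.* (3 ℕ.* x ℕ.+ 8 ℕ.* y) ℕ.+ 20 ℕ.* (x ℕ.+ 3 ℕ.* y)) ℕ.+ 5 ℕ.* y
  collect = solve-∀

total-true-step : ∀ n x y s t {a b u} → a ≡ x ℕ.+ 3 ℕ.* y → b ≡ x ℕ.+ 2 ℕ.* y →
  u ≡ b ℕ.+ 8 ℕ.* a ℕ.+ t ℕ.+ 4 ℕ.* s →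
  4 ℕ.* s ℕ.+ y ≡ n ℕ.* (7 ℕ.* x ℕ.+ 20 ℕ.* y) → 2 ℕ.* t ≡ n ℕ.* (3 ℕ.* x ℕ.+ 8 ℕ.* y) ℕ.+ y →
  2 ℕ.* u ≡ suc n ℕ.* (3 ℕ.* (3 ℕ.* x ℕ.+ 8 ℕ.* y) ℕ.+ 8 ℕ.* (x ℕ.+ 3 ℕ.* y)) ℕ.+ (x ℕ.+ 3 ℕ.* y)
total-true-step n x y s t refl refl refl hs ht = ℕₚ.+-cancelʳ-≡ (2 ℕ.* y) _ _
  (trans (expand x y s t) (trans (cong₂ (λ v w → 18 ℕ.* x ℕ.+ 52 ℕ.* y ℕ.+ v ℕ.+ 2 ℕ.* w) ht hs) (collect n x y)))
  where
  expand : ∀ x y s t → 2 ℕ.* (x ℕ.+ 2 ℕ.* y ℕ.+ 8 ℕ.* (x ℕ.+ 3 ℕ.* y) ℕ.+ t ℕ.+ 4 ℕ.* s) ℕ.+ 2 ℕ.* y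
                     ≡ 18 ℕ.* x ℕ.+ 52 ℕ.* y ℕ.+ 2 ℕ.* t ℕ.+ 2 ℕ.* (4 ℕ.* s ℕ.+ y)
  expand = solve-∀
  collect : ∀ n x y →
    18 ℕ.* x ℕ.+ 52 ℕ.* y ℕ.+ (n ℕ.* (3 ℕ.* x ℕ.+ 8 ℕ.* y) ℕ.+ y) ℕ.+ 2 ℕ.* (n ℕ.* (7 ℕ.* x ℕ.+ 20 ℕ.* y))
    ≡ suc n ℕ.* (3 ℕ.* (3 ℕ.* x ℕ.+ 8 ℕ.* y) ℕ.+ 8 ℕ.* (x ℕ.+ 3 ℕ.* y)) ℕ.+ (x ℕ.+ 3 ℕ.* y) ℕ.+ 2 ℕ.* y
  collect = solve-∀

-- total false n = (n (7x + 20y) - y) / 4 with the y moved to the left, so that no subtraction occurs.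
total-closed : ∀ n → 4 ℕ.* total false n ℕ.+ pellY n ≡ n ℕ.* (7 ℕ.* pellX n ℕ.+ 20 ℕ.* pellY n)
                   × 2 ℕ.* total true n ≡ n ℕ.* (3 ℕ.* pellX n ℕ.+ 8 ℕ.* pellY n) ℕ.+ pellY n
total-closed zero    = refl , refl
total-closed (suc n) =
  let hs , ht = total-closed n
      ha , hb = size-closed n
      hf , hg = total-suc n
  in total-false-step n (pellX n) (pellY n) (total false n) (total true n) ha hb hf hs ht
   , total-true-step n (pellX n) (pellY n) (total false n) (total true n) ha hb hg hs ht

rational : ℕ → ℚ
rational m = + m ℚ./ 1

toℚᵘ-rational : ∀ m → ℚ.toℚᵘ (rational m) ℚᵘ.≃ ℚᵘ.mkℚᵘ (+ m) 0
toℚᵘ-rational m = ℚₚ.toℚᵘ-fromℚᵘ (ℚᵘ.mkℚᵘ (+ m) 0)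

rational-+ : ∀ m n → rational (m ℕ.+ n) ≡ rational m ℚ.+ rational n
rational-+ m n = ℚₚ.toℚᵘ-injective (begin
  ℚ.toℚᵘ (rational (m ℕ.+ n))                            ≈⟨ toℚᵘ-rational (m ℕ.+ n) ⟩
  ℚᵘ.mkℚᵘ (+ (m ℕ.+ n)) 0                                ≈⟨ ℚᵘ.*≡* (cong (ℤ._* (+ 1)) (sym (cong₂ ℤ._+_ (ℤₚ.*-identityʳ (+ m)) (ℤₚ.*-identityʳ (+ n))))) ⟩
  ℚᵘ.mkℚᵘ (+ m) 0 ℚᵘ.+ ℚᵘ.mkℚᵘ (+ n) 0                    ≈⟨ ℚᵘₚ.+-cong (toℚᵘ-rational m) (toℚᵘ-rational n) ⟨
  ℚ.toℚᵘ (rational m) ℚᵘ.+ ℚ.toℚᵘ (rational n)           ≈⟨ ℚₚ.toℚᵘ-homo-+ (rational m) (rational n) ⟨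
  ℚ.toℚᵘ (rational m ℚ.+ rational n)                     ∎)
  where open import Relation.Binary.Reasoning.Setoid ℚᵘₚ.≃-setoid

rational-* : ∀ m n → rational (m ℕ.* n) ≡ rational m ℚ.* rational n
rational-* m n = ℚₚ.toℚᵘ-injective (begin
  ℚ.toℚᵘ (rational (m ℕ.* n))                            ≈⟨ toℚᵘ-rational (m ℕ.* n) ⟩
  ℚᵘ.mkℚᵘ (+ (m ℕ.* n)) 0                                ≈⟨ ℚᵘ.*≡* (cong (ℤ._* (+ 1)) (ℤₚ.pos-* m n)) ⟩
  ℚᵘ.mkℚᵘ (+ m) 0 ℚᵘ.* ℚᵘ.mkℚᵘ (+ n) 0                    ≈⟨ ℚᵘₚ.*-cong (toℚᵘ-rational m) (toℚᵘ-rational n) ⟨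
  ℚ.toℚᵘ (rational m) ℚᵘ.* ℚ.toℚᵘ (rational n)           ≈⟨ ℚₚ.toℚᵘ-homo-* (rational m) (rational n) ⟨
  ℚ.toℚᵘ (rational m ℚ.* rational n)                     ∎)
  where open import Relation.Binary.Reasoning.Setoid ℚᵘₚ.≃-setoid

rational-linear : ∀ a x b y → rational (a ℕ.* x ℕ.+ b ℕ.* y) ≡ rational a ℚ.* rational x ℚ.+ rational b ℚ.* rational y
rational-linear a x b y = trans (rational-+ (a ℕ.* x) (b ℕ.* y)) (cong₂ ℚ._+_ (rational-* a x) (rational-* b y))

pellX-suc : ∀ n → rational (pellX (suc n)) ≡ rational 3 ℚ.* rational (pellX n) ℚ.+ rational 8 ℚ.* rational (pellY n)
pellX-suc n = rational-linear 3 (pellX n) 8 (pellY n)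

pellY-suc : ∀ n → rational (pellY (suc n)) ≡ rational (pellX n) ℚ.+ rational 3 ℚ.* rational (pellY n)
pellY-suc n = trans (rational-+ (pellX n) (3 ℕ.* pellY n)) (cong (rational (pellX n) ℚ.+_) (rational-* 3 (pellY n)))

module _ where
  open ℚ-Solver

  [3+2√2]* : ∀ x y → (ι 3 + ι 2 * √2) * (x +√2· rational 2 ℚ.* y)
                   ≡ (rational 3 ℚ.* x ℚ.+ rational 8 ℚ.* y +√2· rational 2 ℚ.* (x ℚ.+ rational 3 ℚ.* y))
  [3+2√2]* x y = cong₂ _+√2·_
    (solve 2 (λ x y → con (rational 3) :* x :+ con (rational 2) :* (con (rational 2) :* (con (rational 2) :* y))
                   := con (rational 3) :* x :+ con (rational 8) :* y) refl x y)
    (solve 2 (λ x y → con (rational 3) :* (con (rational 2) :* y) :+ con (rational 2) :* x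
                   := con (rational 2) :* (x :+ con (rational 3) :* y)) refl x y)

  [3-2√2]* : ∀ x y → (ι 3 - ι 2 * √2) * (x +√2· ℚ.- (rational 2 ℚ.* y))
                   ≡ (rational 3 ℚ.* x ℚ.+ rational 8 ℚ.* y +√2· ℚ.- (rational 2 ℚ.* (x ℚ.+ rational 3 ℚ.* y)))
  [3-2√2]* x y = cong₂ _+√2·_
    (solve 2 (λ x y → con (rational 3) :* x :+ con (rational 2) :* (con (ℚ.- rational 2) :* (:- (con (rational 2) :* y)))
                   := con (rational 3) :* x :+ con (rational 8) :* y) refl x y)
    (solve 2 (λ x y → con (rational 3) :* (:- (con (rational 2) :* y)) :+ con (ℚ.- rational 2) :* x
                   := :- (con (rational 2) :* (x :+ con (rational 3) :* y))) refl x y)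

  [3+2√2]^n : ∀ n → (ι 3 + ι 2 * √2) ^ n ≡ (rational (pellX n) +√2· rational 2 ℚ.* rational (pellY n))
  [3+2√2]^n zero    = refl
  [3+2√2]^n (suc n) = trans (cong ((ι 3 + ι 2 * √2) *_) ([3+2√2]^n n)) (trans
    ([3+2√2]* (rational (pellX n)) (rational (pellY n)))
    (cong₂ (λ x y → x +√2· rational 2 ℚ.* y) (sym (pellX-suc n)) (sym (pellY-suc n))))

  [3-2√2]^n : ∀ n → (ι 3 - ι 2 * √2) ^ n ≡ (rational (pellX n) +√2· ℚ.- (rational 2 ℚ.* rational (pellY n)))
  [3-2√2]^n zero    = refl
  [3-2√2]^n (suc n) = trans (cong ((ι 3 - ι 2 * √2) *_) ([3-2√2]^n n)) (trans
    ([3-2√2]* (rational (pellX n)) (rational (pellY n)))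
    (cong₂ (λ x y → x +√2· ℚ.- (rational 2 ℚ.* y)) (sym (pellX-suc n)) (sym (pellY-suc n))))

  closed-form : ∀ {d x y N : ℚ} → rational 4 ℚ.* d ℚ.+ y ≡ N ℚ.* (rational 7 ℚ.* x ℚ.+ rational 20 ℚ.* y) →
    let z⁻ = x +√2· ℚ.- (rational 2 ℚ.* y)
        z⁺ = x +√2· rational 2 ℚ.* y
    in (d +√2· 0ℚ) ≡ √2 / 32 * z⁻ + (ι 7 - ι 5 * √2) / 8 * (N +√2· 0ℚ) * z⁻
                   - √2 / 32 * z⁺ + (ι 7 + ι 5 * √2) / 8 * (N +√2· 0ℚ) * z⁺
  closed-form {d} {x} {y} {N} eq = cong₂ _+√2·_
    (trans (solve 2 (λ d y → d := quarter :* (con (rational 4) :* d :+ y :- y)) refl d y)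
      (trans (cong (λ u → (+ 1 ℚ./ 4) ℚ.* (u ℚ.- y)) eq)
        (solve 3 (λ x y N → quarter :* (N :* (con (rational 7) :* x :+ con (rational 20) :* y) :- y)
                         := proj₁ (value x y N)) refl x y N)))
    (solve 3 (λ x y N → con 0ℚ := proj₂ (value x y N)) refl x y N)
    where
    quarter : ∀ {k} → Polynomial k
    quarter = con (+ 1 ℚ./ 4)

    module _ {k : ℕ} where
      infixl 7 _⊛_
      infixl 6 _⊕_ _⊖_
      _⊛_ _⊕_ _⊖_ : Polynomial k × Polynomial k → Polynomial k × Polynomial k → Polynomial k × Polynomial k
      (a , b) ⊛ (c , d) = a :* c :+ con (rational 2) :* (b :* d) , a :* d :+ b :* c
      (a , b) ⊕ (c , d) = a :+ c , b :+ d
      (a , b) ⊖ (c , d) = a :- c , b :- d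
      constant : ℚ⟨√2⟩ → Polynomial k × Polynomial k
      constant (a +√2· b) = con a , con b

    value : ∀ {k} → Polynomial k → Polynomial k → Polynomial k → Polynomial k × Polynomial k
    value x y N = constant (√2 / 32) ⊛ z⁻ ⊕ constant ((ι 7 - ι 5 * √2) / 8) ⊛ (N , con 0ℚ) ⊛ z⁻
                ⊖ constant (√2 / 32) ⊛ z⁺ ⊕ constant ((ι 7 + ι 5 * √2) / 8) ⊛ (N , con 0ℚ) ⊛ z⁺
      where
      z⁻ = x , :- (con (rational 2) :* y)
      z⁺ = x , con (rational 2) :* y

rational-total : ∀ n → rational 4 ℚ.* rational (total false n) ℚ.+ rational (pellY n)
                     ≡ rational n ℚ.* (rational 7 ℚ.* rational (pellX n) ℚ.+ rational 20 ℚ.* rational (pellY n))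
rational-total n = begin
  rational 4 ℚ.* rational (total false n) ℚ.+ rational y   ≡⟨ cong (ℚ._+ rational y) (rational-* 4 (total false n)) ⟨
  rational (4 ℕ.* total false n) ℚ.+ rational y            ≡⟨ rational-+ (4 ℕ.* total false n) y ⟨
  rational (4 ℕ.* total false n ℕ.+ y)                     ≡⟨ cong rational (proj₁ (total-closed n)) ⟩
  rational (n ℕ.* (7 ℕ.* x ℕ.+ 20 ℕ.* y))                  ≡⟨ rational-* n (7 ℕ.* x ℕ.+ 20 ℕ.* y) ⟩
  rational n ℚ.* rational (7 ℕ.* x ℕ.+ 20 ℕ.* y)           ≡⟨ cong (rational n ℚ.*_) (rational-linear 7 x 20 y) ⟩
  rational n ℚ.* (rational 7 ℚ.* rational x ℚ.+ rational 20 ℚ.* rational y) ∎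
  where
  open ≡-Reasoning
  x = pellX n
  y = pellY n

theorem3p4 : (n : ℕ) →
    ι (IDF (H n)) ≡
    √2 / 32 * (ι 3 - ι 2 * √2) ^ n
    + (ι 7 - ι 5 * √2) / 8 * ι n * (ι 3 - ι 2 * √2) ^ n
    - √2 / 32 * (ι 3 + ι 2 * √2) ^ n
    + (ι 7 + ι 5 * √2) / 8 * ι n * (ι 3 + ι 2 * √2) ^ n
theorem3p4 n = begin
  ι (IDF (H n))       ≡⟨ cong ι (IDF-H n) ⟩
  ι (total false n)   ≡⟨ closed-form {N = rational n} (rational-total n) ⟩
  _                   ≡⟨ cong₂ (λ z⁻ z⁺ → √2 / 32 * z⁻ + (ι 7 - ι 5 * √2) / 8 * ι n * z⁻
                                        - √2 / 32 * z⁺ + (ι 7 + ι 5 * √2) / 8 * ι n * z⁺)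
                               ([3-2√2]^n n) ([3+2√2]^n n) ⟨
  _                   ∎
  where open ≡-Reasoning
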